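{- Let $\alpha$ be a composition of $n$. Then $\mathcal p_\alpha=\sum_{\beta\vDash n}\mathcal R_{\alpha\beta}M_\beta$, where $\mathcal R_{\alpha\beta}$ is the number of $\ell(\beta)\times\ell(\alpha)$ matrices $(m_{ij})$ whose nonzero entries are the parts of $\alpha$ such that (1) $\sum_{j=1}^{\ell(\alpha)}m_{ij}=\beta_i$ for each row $i$; (2) the only nonzero entry in column $j$ is $\widetilde\alpha_j$; (3) the nonzero entries give $\alpha$ when read left to right and top to bottom.
   Context: Let $\mathbb N=\{1,2,\dots\}$. A composition $\alpha=\alpha_1\cdots\alpha_\ell$ of $n$ ($\alpha\vDash n$) is a sequence of positive integers summing to $n$, $\ell(\alpha)=\ell$; $\widetilde\alpha=\widetilde\alpha_1\cdots\widetilde\alpha_\ell$ is its parts sorted in weakly decreasing order. $M_\beta=\sum_{i_1<\dots<i_{\ell(\beta)}}x_{i_1}^{\beta_1}\cdots x_{i_{\ell(\beta)}}^{\beta_{\ell(\beta)}}$ is the monomial quasisymmetric function. A labelling of a finite poset $P$ is an injective map $\gamma$ into a chain; a weight function is $w:P\to\mathbb N$. A $(P,\gamma)$-partition is $f:P\to\mathbb N$ with, for all $p<q$, $f(p)\le f(q)$ and $f(p)=f(q)\Rightarrow\gamma(p)<\gamma(q)$. $K_{(P,\gamma,w)}=\sum_f\prod_{u\in P}x_{f(u)}^{w(u)}$ over all $(P,\gamma)$-partitions. For a chain $u_1<\dots<u_\ell$, $\alpha(s,w)=(w(u_1),\dots,w(u_\ell))$. Let $\mathbb N_{\mathbb N}=\{a_k:a,k\in\mathbb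 N\}$ ordered by $a_k<b_l$ iff $a<b$, or $a=b$ and $k<l$; $\mathbb N_{\mathbb N}^*$ is its reverse. For $\widetilde\alpha=m^{r_m}\cdots1^{r_1}$ ($r_i$ parts equal to $i$), $P^{\widetilde\alpha}$ is the antichain on $\{a_k:1\le a\le m,1\le k\le r_a\}$ with $w(a_k)=a$ and labelling $\gamma$ the inclusion into $\mathbb N_{\mathbb N}^*$. The combinatorial power sum is $\mathcal p_\alpha=\sum_sK_{(s,\gamma,w)}$ over linear extensions $s$ of $P^{\widetilde\alpha}$ with $\alpha(s,w)=\alpha$. -}

module Defs where

open import Data.Nat using (ℕ; zero; suc; _+_; _*_; _<_; _≡ᵇ_; _<ᵇ_; _≤ᵇ_)
open import Data.Bool using (Bool; true; false; _∧_; _∨_; not; if_then_else_)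
open import Data.List using (List; []; _∷_; map; concat; concatMap; filterᵇ; length; upTo; zip; zipWith)
open import Data.Nat.ListAction using (sum)
open import Data.Bool.ListAction using (and; all)
open import Data.List.Relation.Unary.All using (All)
open import Data.Product using (_×_; _,_; proj₁; proj₂)
open import Relation.Binary.PropositionalEquality using (_≡_)

range1 : ℕ → List ℕ
range1 n = map suc (upTo n)

range0 : ℕ → List ℕ
range0 n = upTo (suc n)

seqs : {A : Set} → List A → ℕ → List (List A)
seqs xs zero    = [] ∷ []
seqs xs (suc k) = concatMap (λ x → map (x ∷_) (seqs xs k)) xs

countᵇ : {A : Set} → (A → Bool) → List A → ℕ
countᵇ p xs = length (filterᵇ p xs)

eqListᵇ : List ℕ → List ℕ → Bool
eqListᵇ []       []       = true
eqListᵇ []       (_ ∷ _)  = false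
eqListᵇ (_ ∷ _)  []       = false
eqListᵇ (x ∷ xs) (y ∷ ys) = (x ≡ᵇ y) ∧ eqListᵇ xs ys

pairwiseᵇ : {A : Set} → (A → A → Bool) → List A → Bool
pairwiseᵇ R []       = true
pairwiseᵇ R (x ∷ xs) = all (R x) xs ∧ pairwiseᵇ R xs

insertions : {A : Set} → A → List A → List (List A)
insertions x []       = (x ∷ []) ∷ []
insertions x (y ∷ ys) = (x ∷ y ∷ ys) ∷ map (y ∷_) (insertions x ys)

perms : {A : Set} → List A → List (List A)
perms []       = [] ∷ []
perms (x ∷ xs) = concatMap (insertions x) (perms xs)

-- i-th entry (0-based), 0 if out of range
nth : List ℕ → ℕ → ℕ
nth []       _       = 0
nth (x ∷ xs) zero    = x
nth (x ∷ xs) (suc i) = nth xs i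

nonzeroᵇ : ℕ → Bool
nonzeroᵇ x = not (x ≡ᵇ 0)

IsComposition : ℕ → List ℕ → Set
IsComposition n α = All (λ a → 0 < a) α × sum α ≡ n

isCompositionᵇ : ℕ → List ℕ → Bool
isCompositionᵇ n α = all (λ a → 0 <ᵇ a) α ∧ (sum α ≡ᵇ n)

-- all compositions of n (a composition of n has length ≤ n and parts in 1..n)
compositions : ℕ → List (List ℕ)
compositions n =
  concatMap (λ l → filterᵇ (isCompositionᵇ n) (seqs (range1 n) l)) (range0 n)

insertDesc : ℕ → List ℕ → List ℕ
insertDesc x []       = x ∷ []
insertDesc x (y ∷ ys) = if y ≤ᵇ x then x ∷ y ∷ ys else y ∷ insertDesc x ys

sortDesc : List ℕ → List ℕ
sortDesc []       = []
sortDesc (x ∷ xs) = insertDesc x (sortDesc xs)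

-- Monomials.  A monomial x_1^{e_1} ⋯ x_N^{e_N} is represented by its
-- exponent list e = e_1 ∷ ⋯ ∷ e_N (N = length e).  A formal power series
-- in x_1, x_2, … is determined by its coefficients at all such e.

-- exponent list (x_1..x_N) of ∏_i x_{v_i}^{w_i} for pairs (v_i , w_i)
expVec : ℕ → List (ℕ × ℕ) → List ℕ
expVec N vw =
  map (λ v → sum (map proj₂ (filterᵇ (λ p → proj₁ p ≡ᵇ v) vw))) (range1 N)

-- coefficient of x^e in M_β : number of index sequences i_1 < ⋯ < i_ℓ
-- with x_{i_1}^{β_1} ⋯ x_{i_ℓ}^{β_ℓ} = x^e.  (Indices > N cannot occur
-- since parts of β are positive.)
coeffM : List ℕ → List ℕ → ℕ
coeffM β e =
  countᵇ (λ is → pairwiseᵇ _<ᵇ_ is ∧ eqListᵇ (expVec (length e) (zip is β)) e)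
         (seqs (range1 (length e)) (length β))

-- elements a_k of N_N are pairs (a , k)
NN : Set
NN = ℕ × ℕ

_<NNᵇ_ : NN → NN → Bool
(a , k) <NNᵇ (b , l) = (a <ᵇ b) ∨ ((a ≡ᵇ b) ∧ (k <ᵇ l))

-- γ is the inclusion into N_N^* (reverse order) : γ p < γ q iff q < p in N_N
_<γᵇ_ : NN → NN → Bool
p <γᵇ q = q <NNᵇ p

wt : NN → ℕ
wt = proj₁

mult : ℕ → List ℕ → ℕ
mult a α = countᵇ (a ≡ᵇ_) α

-- elements of P^{α̃} : a_k with 1 ≤ a (≤ m), 1 ≤ k ≤ r_a
-- (values a beyond the largest part have r_a = 0 and contribute nothing)
elemsP : List ℕ → List NN
elemsP α = concatMap (λ a → map (λ k → (a , k)) (range1 (mult a α))) (range1 (sum α))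

-- P^{α̃} is an antichain, so its linear extensions are all total orderings
-- u_1 < ⋯ < u_ℓ of its elements
linearExtensions : List ℕ → List (List NN)
linearExtensions α = perms (elemsP α)

αsw : List NN → List ℕ
αsw s = map wt s

-- f (given by its values f(u_1), …, f(u_ℓ)) is an (s,γ)-partition of the chain s:
-- for all u_i < u_j : f(u_i) ≤ f(u_j) and (f(u_i) = f(u_j) ⇒ γ(u_i) < γ(u_j))
isPartitionᵇ : List NN → List ℕ → Bool
isPartitionᵇ s f =
  pairwiseᵇ (λ p q → (proj₂ p ≤ᵇ proj₂ q) ∧ (not (proj₂ p ≡ᵇ proj₂ q) ∨ (proj₁ p <γᵇ proj₁ q)))
            (zip s f)

-- coefficient of x^e in K_{(s,γ,w)} for a chain s.  (Values of f beyond
-- N = length e cannot occur since all weights are positive.)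
coeffK : List NN → List ℕ → ℕ
coeffK s e =
  countᵇ (λ f → isPartitionᵇ s f ∧ eqListᵇ (expVec (length e) (zip f (map wt s))) e)
         (seqs (range1 (length e)) (length s))

coeffP : List ℕ → List ℕ → ℕ
coeffP α e =
  sum (map (λ s → coeffK s e)
           (filterᵇ (λ s → eqListᵇ (αsw s) α) (linearExtensions α)))

-- a matrix is a list of ℓ(β) rows, each a list of ℓ(α) naturals
columns : ℕ → List (List ℕ) → List (List ℕ)
columns c m = map (λ j → map (λ row → nth row j) m) (upTo c)

columnOKᵇ : List ℕ → ℕ → Bool
columnOKᵇ col a = (countᵇ nonzeroᵇ col ≡ᵇ 1) ∧ all (λ x → (x ≡ᵇ 0) ∨ (x ≡ᵇ a)) col

matrixOKᵇ : List ℕ → List ℕ → List (List ℕ) → Bool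
matrixOKᵇ α β m =
  eqListᵇ (map sum m) β
  ∧ and (zipWith columnOKᵇ (columns (length α) m) (sortDesc α))
  ∧ eqListᵇ (filterᵇ nonzeroᵇ (concat m)) α

-- R_{αβ} : number of ℓ(β) × ℓ(α) matrices satisfying (1)-(3).
-- Entries are enumerated in 0..|α|; this loses nothing since by (2) every
-- entry is 0 or a part of α.
Rαβ : List ℕ → List ℕ → ℕ
Rαβ α β = countᵇ (matrixOKᵇ α β) (seqs (seqs (range0 (sum α)) (length α)) (length β))

module Submission where

open import Defs
open import Data.Bool using (Bool; true; false; _∧_; _∨_; not; if_then_else_)
open import Data.Bool.ListAction using (and; or; all; any)
open import Data.Bool.Properties using (∧-assoc; ∧-comm; ∧-identityʳ; ∧-zeroʳ; ∨-identityʳ; ∨-zeroʳ; T-≡)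
open import Data.List
  using (List; []; _∷_; _++_; map; concat; concatMap; filterᵇ; foldr; length; replicate; reverse; upTo; zip; zipWith)
open import Data.List.Properties hiding (sum-++)
open import Data.List.Relation.Binary.Permutation.Propositional as Perm
  using (_↭_; ↭⇒↭ₛ; ↭-reflexive; ↭-sym; ↭-trans)
open import Data.List.Relation.Binary.Permutation.Propositional.Properties as Perm
  using (filter-↭; ↭-reverse; ++⁺ˡ; shift)
open import Data.List.Relation.Binary.Pointwise using (Pointwise-≡⇒≡)
open import Data.List.Relation.Unary.All as All using (All; []; _∷_)
import Data.List.Relation.Unary.All.Properties as All
open import Data.List.Relation.Unary.AllPairs as AllPairs using (AllPairs; []; _∷_)
import Data.List.Relation.Unary.AllPairs.Properties as AllPairs
open import Data.List.Relation.Unary.Sorted.TotalOrder.Properties using (AllPairs⇒Sorted; ↗↭↗⇒≋)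
open import Data.Nat
open import Data.Nat.ListAction using (sum)
open import Data.Nat.ListAction.Properties using (sum-++; sum-↭)
open import Data.Nat.Properties
open import Data.Nat.Tactic.RingSolver using (solve-∀)
open import Data.Product using (_×_; _,_; proj₁; proj₂; map₁; map₂; swap)
open import Function using (_∘_; id; flip; case_of_; Equivalence)
open import Relation.Binary.Bundles using (DecTotalOrder)
import Relation.Binary.Construct.Flip.EqAndOrd as Flip
open import Relation.Binary.PropositionalEquality
open ≡-Reasoning

-- A matrix satisfying (2) is the same as a map g from columns to rows, that is, from P^α̃ to the
-- variables, the columns being the elements of P^α̃ in decreasing order of N_N.  For every g there is
-- exactly one linear extension s for which g is an (s,γ)-partition: sort P^α̃ by g, breaking ties by γ.
-- Its weights are the reading word of the matrix, and the row sums of the matrix are the exponents of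
-- the monomial.  So the coefficient of x^e in 𝓅_α is R_{α,e}, zero rows allowed; deleting the zero
-- rows turns e into the only composition β for which x^e occurs in M_β.

-- No bijection is written down: each equality is an induction over the enumerations `perms` and
-- `seqs`, with an arbitrary weight `F`, `G` or `H` that absorbs what has already been chosen. The
-- two sides meet in the function `insert`. Adding a column on the left of a matrix puts its entry
-- at the front of its row in the reading word. Adding an element that is larger in N_N to a chain
-- puts it in front of all elements with the same value of f, because γ reverses the order. Both are
-- insertions by row with ties in front, so both produce `sortRows`. This requires each new element
-- to exceed those already present, so the list given to `perms` must decrease, whereas `elemsP`
-- increases; hence sums over `perms` are shown not to depend on the order of the list.

private variable
  A B : Set

-- Finite sums

∑ : List A → (A → ℕ) → ℕ
∑ xs f = sum (map f xs)

infix 5 ∑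
syntax ∑ xs (λ x → t) = ∑[ x ∈ xs ] t

⟦_⟧ : Bool → ℕ
⟦ true ⟧  = 1
⟦ false ⟧ = 0

⟦∧⟧ : ∀ a b → ⟦ a ∧ b ⟧ ≡ ⟦ a ⟧ * ⟦ b ⟧
⟦∧⟧ true  b = sym (*-identityˡ _)
⟦∧⟧ false b = refl

-- Allows rewriting under the assumption that the indicator in front equals 1.
guard-cong : ∀ b {x y} → (b ≡ true → x ≡ y) → ⟦ b ⟧ * x ≡ ⟦ b ⟧ * y
guard-cong true  eq = cong (1 *_) (eq refl)
guard-cong false eq = refl

*-swapˡ : ∀ a b c → a * (b * c) ≡ b * (a * c)
*-swapˡ a b c = begin
  a * (b * c) ≡⟨ *-assoc a b c ⟨
  a * b * c   ≡⟨ cong (_* c) (*-comm a b) ⟩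
  b * a * c   ≡⟨ *-assoc b a c ⟩
  b * (a * c) ∎

∑-cong : ∀ {f g : A → ℕ} xs → (∀ x → f x ≡ g x) → ∑ xs f ≡ ∑ xs g
∑-cong xs eq = cong sum (map-cong eq xs)

∑-cong-local : ∀ {f g : A → ℕ} {xs} → All (λ x → f x ≡ g x) xs → ∑ xs f ≡ ∑ xs g
∑-cong-local eqs = cong sum (map-cong-local eqs)

∑-++ : ∀ (f : A → ℕ) xs ys → ∑ (xs ++ ys) f ≡ ∑ xs f + ∑ ys f
∑-++ f xs ys = trans (cong sum (map-++ f xs ys)) (sum-++ (map f xs) (map f ys))

∑-map : ∀ (f : B → ℕ) (h : A → B) xs → ∑ (map h xs) f ≡ ∑ xs (f ∘ h)
∑-map f h xs = cong sum (sym (map-∘ xs))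

∑-concatMap : ∀ (f : B → ℕ) (h : A → List B) xs →
  ∑ (concatMap h xs) f ≡ ∑[ x ∈ xs ] ∑ (h x) f
∑-concatMap f h []       = refl
∑-concatMap f h (x ∷ xs) =
  trans (∑-++ f (h x) (concatMap h xs)) (cong (∑ (h x) f +_) (∑-concatMap f h xs))

∑-zero : ∀ (xs : List A) → (∑[ x ∈ xs ] 0) ≡ 0
∑-zero []       = refl
∑-zero (x ∷ xs) = ∑-zero xs

∑-+ : ∀ (f g : A → ℕ) xs → (∑[ x ∈ xs ] (f x + g x)) ≡ ∑ xs f + ∑ xs g
∑-+ f g []       = refl
∑-+ f g (x ∷ xs) = begin
  f x + g x + ∑ xs (λ y → f y + g y) ≡⟨ cong (f x + g x +_) (∑-+ f g xs) ⟩
  f x + g x + (∑ xs f + ∑ xs g)      ≡⟨ +-assoc (f x) (g x) _ ⟩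
  f x + (g x + (∑ xs f + ∑ xs g))    ≡⟨ cong (f x +_) (+-assoc (g x) _ _) ⟨
  f x + (g x + ∑ xs f + ∑ xs g)      ≡⟨ cong (λ n → f x + (n + ∑ xs g)) (+-comm (g x) _) ⟩
  f x + (∑ xs f + g x + ∑ xs g)      ≡⟨ cong (f x +_) (+-assoc (∑ xs f) _ _) ⟩
  f x + (∑ xs f + (g x + ∑ xs g))    ≡⟨ +-assoc (f x) _ _ ⟨
  f x + ∑ xs f + (g x + ∑ xs g)      ∎

∑-*ˡ : ∀ c (f : A → ℕ) xs → (∑[ x ∈ xs ] c * f x) ≡ c * ∑ xs f
∑-*ˡ c f []       = sym (*-zeroʳ c)
∑-*ˡ c f (x ∷ xs) = trans (cong (c * f x +_) (∑-*ˡ c f xs)) (sym (*-distribˡ-+ c (f x) _))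

∑-swap : ∀ (f : A → B → ℕ) xs ys →
  (∑[ x ∈ xs ] ∑[ y ∈ ys ] f x y) ≡ (∑[ y ∈ ys ] ∑[ x ∈ xs ] f x y)
∑-swap f []       ys = sym (∑-zero ys)
∑-swap f (x ∷ xs) ys =
  trans (cong (∑ ys (f x) +_) (∑-swap f xs ys))
        (sym (∑-+ (f x) (λ y → ∑[ x′ ∈ xs ] f x′ y) ys))

∑-seqs : ∀ (xs : List A) k (f : List A → ℕ) →
  ∑ (seqs xs (suc k)) f ≡ (∑[ x ∈ xs ] ∑[ ys ∈ seqs xs k ] f (x ∷ ys))
∑-seqs xs k f = trans (∑-concatMap f (λ x → map (x ∷_) (seqs xs k)) xs)
                      (∑-cong xs λ x → ∑-map f (x ∷_) (seqs xs k))

∑-seqs-map : ∀ (h : A → B) xs k (f : List B → ℕ) →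
  ∑ (seqs (map h xs) k) f ≡ ∑ (seqs xs k) (f ∘ map h)
∑-seqs-map h xs zero    f = refl
∑-seqs-map h xs (suc k) f = begin
  ∑ (seqs (map h xs) (suc k)) f
    ≡⟨ ∑-seqs (map h xs) k f ⟩
  (∑[ y ∈ map h xs ] ∑[ ys ∈ seqs (map h xs) k ] f (y ∷ ys))
    ≡⟨ ∑-map _ h xs ⟩
  (∑[ x ∈ xs ] ∑[ ys ∈ seqs (map h xs) k ] f (h x ∷ ys))
    ≡⟨ ∑-cong xs (λ x → ∑-seqs-map h xs k (f ∘ (h x ∷_))) ⟩
  (∑[ x ∈ xs ] ∑[ ys ∈ seqs xs k ] f (h x ∷ map h ys))
    ≡⟨ ∑-seqs xs k (f ∘ map h) ⟨
  ∑ (seqs xs (suc k)) (f ∘ map h) ∎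

∑-filter : ∀ p (f : A → ℕ) xs → ∑ (filterᵇ p xs) f ≡ (∑[ x ∈ xs ] ⟦ p x ⟧ * f x)
∑-filter p f []       = refl
∑-filter p f (x ∷ xs) with p x
... | true  = cong₂ _+_ (sym (*-identityˡ (f x))) (∑-filter p f xs)
... | false = ∑-filter p f xs

countᵇ-∑ : ∀ p (xs : List A) → countᵇ p xs ≡ (∑[ x ∈ xs ] ⟦ p x ⟧)
countᵇ-∑ p []       = refl
countᵇ-∑ p (x ∷ xs) with p x
... | true  = cong suc (countᵇ-∑ p xs)
... | false = countᵇ-∑ p xs

seqs-length : ∀ (xs : List A) k → All (λ ys → length ys ≡ k) (seqs xs k)
seqs-length xs zero    = refl ∷ []
seqs-length xs (suc k) =
  All.concat⁺ (All.map⁺ (All.universal (λ x → All.map⁺ (All.map (cong suc) (seqs-length xs k))) xs))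

upTo-suc : ∀ n → upTo (suc n) ≡ 0 ∷ map suc (upTo n)
upTo-suc n = cong (0 ∷_) (sym (map-applyUpTo id suc n))

∑-upTo-suc : ∀ (f : ℕ → ℕ) n → ∑ (upTo (suc n)) f ≡ f 0 + ∑ (upTo n) (f ∘ suc)
∑-upTo-suc f n = trans (cong (λ xs → ∑ xs f) (upTo-suc n)) (cong (f 0 +_) (∑-map f suc (upTo n)))

∑-δ : ∀ (f : ℕ → ℕ) {m n} → m < n → (∑[ i ∈ upTo n ] ⟦ i ≡ᵇ m ⟧ * f i) ≡ f m
∑-δ f {zero}  {suc n} m<n       = begin
  ∑ (upTo (suc n)) (λ i → ⟦ i ≡ᵇ 0 ⟧ * f i) ≡⟨ ∑-upTo-suc (λ i → ⟦ i ≡ᵇ 0 ⟧ * f i) n ⟩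
  1 * f 0 + (∑[ i ∈ upTo n ] 0)             ≡⟨ cong₂ _+_ (*-identityˡ (f 0)) (∑-zero (upTo n)) ⟩
  f 0 + 0                                   ≡⟨ +-identityʳ (f 0) ⟩
  f 0                                       ∎
∑-δ f {suc m} {suc n} (s≤s m<n) =
  trans (∑-upTo-suc (λ i → ⟦ i ≡ᵇ suc m ⟧ * f i) n) (∑-δ (f ∘ suc) m<n)

-- Naturals with sum zero all vanish. This serves both for the entries below the nonzero one in a
-- column and for a row of sum zero.
∑-seqs-zero : ∀ n k (f : List ℕ → ℕ) →
  (∑[ xs ∈ seqs (upTo (suc n)) k ] ⟦ sum xs ≡ᵇ 0 ⟧ * f xs) ≡ f (replicate k 0)
∑-seqs-zero n zero    f = trans (+-identityʳ (1 * f [])) (*-identityˡ (f []))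
∑-seqs-zero n (suc k) f = begin
  (∑[ xs ∈ seqs V (suc k) ] ⟦ sum xs ≡ᵇ 0 ⟧ * f xs)
    ≡⟨ ∑-seqs V k _ ⟩
  (∑[ x ∈ V ] ∑[ xs ∈ seqs V k ] ⟦ x + sum xs ≡ᵇ 0 ⟧ * f (x ∷ xs))
    ≡⟨ ∑-upTo-suc _ n ⟩
  (∑[ xs ∈ seqs V k ] ⟦ sum xs ≡ᵇ 0 ⟧ * f (0 ∷ xs)) + (∑[ x ∈ upTo n ] ∑[ xs ∈ seqs V k ] 0)
    ≡⟨ cong₂ _+_ (∑-seqs-zero n k (f ∘ (0 ∷_)))
                 (trans (∑-cong (upTo n) λ _ → ∑-zero (seqs V k)) (∑-zero (upTo n))) ⟩
  f (replicate (suc k) 0) + 0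
    ≡⟨ +-identityʳ _ ⟩
  f (replicate (suc k) 0) ∎
  where V = upTo (suc n)

map-const : ∀ (b : B) (xs : List A) → map (λ _ → b) xs ≡ replicate (length xs) b
map-const b []       = refl
map-const b (x ∷ xs) = cong (b ∷_) (map-const b xs)

-- Sorting linear extensions

-- Either order of insertion yields the same lists up to order; they are grouped by which of the two
-- new elements precede `z`.
∑-insertions-comm : ∀ (f : List A → ℕ) x y zs →
  (∑[ t ∈ insertions x zs ] ∑ (insertions y t) f) ≡
  (∑[ t ∈ insertions y zs ] ∑ (insertions x t) f)
∑-insertions-comm f x y []       = flip-sum (f (y ∷ x ∷ [])) (f (x ∷ y ∷ []))
  where
  flip-sum : ∀ a b → a + (b + 0) + 0 ≡ b + (a + 0) + 0
  flip-sum = solve-∀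
∑-insertions-comm f x y (z ∷ zs) = begin
  (∑[ t ∈ insertions x (z ∷ zs) ] ∑ (insertions y t) f)
    ≡⟨ expand x y ⟩
  f (y ∷ x ∷ z ∷ zs) + (f (x ∷ y ∷ z ∷ zs) + Z y x) + (Z x y + D x y)
    ≡⟨ cong (λ d → f (y ∷ x ∷ z ∷ zs) + (f (x ∷ y ∷ z ∷ zs) + Z y x) + (Z x y + d))
            (∑-insertions-comm (f ∘ (z ∷_)) x y zs) ⟩
  f (y ∷ x ∷ z ∷ zs) + (f (x ∷ y ∷ z ∷ zs) + Z y x) + (Z x y + D y x)
    ≡⟨ rearrange (f (y ∷ x ∷ z ∷ zs)) (f (x ∷ y ∷ z ∷ zs)) (Z y x) (Z x y) (D y x) ⟩
  f (x ∷ y ∷ z ∷ zs) + (f (y ∷ x ∷ z ∷ zs) + Z x y) + (Z y x + D y x)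
    ≡⟨ expand y x ⟨
  (∑[ t ∈ insertions y (z ∷ zs) ] ∑ (insertions x t) f) ∎
  where
  Z D : _ → _ → ℕ
  -- In `Z a b` only `b` stands before `z`; in `D a b` both elements stand after it.
  Z a b = ∑[ t ∈ insertions a zs ] f (b ∷ z ∷ t)
  D a b = ∑[ t ∈ insertions a zs ] ∑ (insertions b t) (f ∘ (z ∷_))

  expand : ∀ a b → (∑[ t ∈ insertions a (z ∷ zs) ] ∑ (insertions b t) f) ≡
    f (b ∷ a ∷ z ∷ zs) + (f (a ∷ b ∷ z ∷ zs) + Z b a) + (Z a b + D a b)
  expand a b = cong₂ _+_
    (cong (f (b ∷ a ∷ z ∷ zs) +_)
      (trans (∑-map f (a ∷_) (insertions b (z ∷ zs)))
             (cong (f (a ∷ b ∷ z ∷ zs) +_) (∑-map (f ∘ (a ∷_)) (z ∷_) (insertions b zs)))))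
    (trans (∑-map (λ t → ∑ (insertions b t) f) (z ∷_) (insertions a zs))
      (trans (∑-cong (insertions a zs)
               (λ t → cong (f (b ∷ z ∷ t) +_) (∑-map f (z ∷_) (insertions b t))))
             (∑-+ _ _ (insertions a zs))))

  rearrange : ∀ a b c d e → a + (b + c) + (d + e) ≡ b + (a + d) + (c + e)
  rearrange = solve-∀

-- This permits the reversal of `elemsP`, after which the head, inserted last, is the largest
-- element in N_N.
∑-perms-↭ : ∀ (f : List A → ℕ) {xs ys} → xs ↭ ys → ∑ (perms xs) f ≡ ∑ (perms ys) f
∑-perms-↭ f Perm.refl = refl
∑-perms-↭ f (Perm.prep {xs} {ys} x p) = begin
  ∑ (perms (x ∷ xs)) f
    ≡⟨ ∑-concatMap f (insertions x) (perms xs) ⟩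
  (∑[ s ∈ perms xs ] ∑ (insertions x s) f)
    ≡⟨ ∑-perms-↭ _ p ⟩
  (∑[ s ∈ perms ys ] ∑ (insertions x s) f)
    ≡⟨ ∑-concatMap f (insertions x) (perms ys) ⟨
  ∑ (perms (x ∷ ys)) f ∎
∑-perms-↭ f (Perm.swap {xs} {ys} x y p) = begin
  ∑ (perms (x ∷ y ∷ xs)) f
    ≡⟨ expand x y xs ⟩
  (∑[ s ∈ perms xs ] ∑[ t ∈ insertions y s ] ∑ (insertions x t) f)
    ≡⟨ ∑-cong (perms xs) (∑-insertions-comm f y x) ⟩
  (∑[ s ∈ perms xs ] ∑[ t ∈ insertions x s ] ∑ (insertions y t) f)
    ≡⟨ ∑-perms-↭ _ p ⟩
  (∑[ s ∈ perms ys ] ∑[ t ∈ insertions x s ] ∑ (insertions y t) f)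
    ≡⟨ expand y x ys ⟨
  ∑ (perms (y ∷ x ∷ ys)) f ∎
  where
  expand : ∀ x y xs → ∑ (perms (x ∷ y ∷ xs)) f ≡
    (∑[ s ∈ perms xs ] ∑[ t ∈ insertions y s ] ∑ (insertions x t) f)
  expand x y xs = trans (∑-concatMap f (insertions x) (perms (y ∷ xs)))
                        (∑-concatMap _ (insertions y) (perms xs))
∑-perms-↭ f (Perm.trans p q) = trans (∑-perms-↭ f p) (∑-perms-↭ f q)

All-insertions : ∀ {P : A → Set} {x xs} → P x → All P xs → All (All P) (insertions x xs)
All-insertions px []         = (px ∷ []) ∷ []
All-insertions px (py ∷ pxs) =
  (px ∷ py ∷ pxs) ∷ All.map⁺ (All.map (py ∷_) (All-insertions px pxs))

All-perms : ∀ {P : A → Set} {xs} → All P xs → All (All P) (perms xs)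
All-perms []         = [] ∷ []
All-perms (px ∷ pxs) = All.concat⁺ (All.map⁺ (All.map (All-insertions px) (All-perms pxs)))

all-insertions : ∀ (r : A → Bool) x xs →
  All (λ t → all r t ≡ r x ∧ all r xs) (insertions x xs)
all-insertions r x []       = refl ∷ []
all-insertions r x (y ∷ ys) = refl ∷ All.map⁺ (All.map (λ {t} → rotate {t}) (all-insertions r x ys))
  where
  rotate : ∀ {t} → all r t ≡ r x ∧ all r ys → r y ∧ all r t ≡ r x ∧ (r y ∧ all r ys)
  rotate {t} eq = begin
    r y ∧ all r t           ≡⟨ cong (r y ∧_) eq ⟩
    r y ∧ (r x ∧ all r ys)  ≡⟨ ∧-assoc (r y) (r x) _ ⟨
    (r y ∧ r x) ∧ all r ys  ≡⟨ cong (_∧ all r ys) (∧-comm (r y) (r x)) ⟩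
    (r x ∧ r y) ∧ all r ys  ≡⟨ ∧-assoc (r x) (r y) _ ⟩
    r x ∧ (r y ∧ all r ys)  ∎

-- The position of `x` and its value can be chosen independently, so a linear extension together
-- with f can be treated as one chain of pairs into which `(x , v)` is inserted.
∑-insertions-zip : ∀ (R : List B) (G : List (A × B) → ℕ) x s →
  (∑[ t ∈ insertions x s ] ∑[ f ∈ seqs R (length t) ] G (zip t f)) ≡
  (∑[ v ∈ R ] ∑[ f ∈ seqs R (length s) ] ∑ (insertions (x , v) (zip s f)) G)
∑-insertions-zip R G x []      = begin
  ∑ (seqs R 1) (G ∘ zip (x ∷ [])) + 0
    ≡⟨ +-identityʳ _ ⟩
  ∑ (seqs R 1) (G ∘ zip (x ∷ []))
    ≡⟨ ∑-seqs R 0 _ ⟩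
  (∑[ v ∈ R ] (G ((x , v) ∷ []) + 0))
    ≡⟨ ∑-cong R (λ v → sym (+-identityʳ _)) ⟩
  (∑[ v ∈ R ] ((G ((x , v) ∷ []) + 0) + 0)) ∎
∑-insertions-zip R G x (y ∷ s) = begin
  (∑[ t ∈ insertions x (y ∷ s) ] ∑[ f ∈ seqs R (length t) ] G (zip t f))
    ≡⟨ cong₂ _+_ (∑-seqs R (suc (length s)) _) (∑-map _ (y ∷_) (insertions x s)) ⟩
  X + (∑[ t ∈ insertions x s ] ∑[ f ∈ seqs R (suc (length t)) ] G (zip (y ∷ t) f))
    ≡⟨ cong (X +_) (∑-cong (insertions x s) λ t → ∑-seqs R (length t) _) ⟩
  X + (∑[ t ∈ insertions x s ] ∑[ w ∈ R ] ∑[ f ∈ seqs R (length t) ] G ((y , w) ∷ zip t f))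
    ≡⟨ cong (X +_) (∑-swap _ (insertions x s) R) ⟩
  X + (∑[ w ∈ R ] ∑[ t ∈ insertions x s ] ∑[ f ∈ seqs R (length t) ] G ((y , w) ∷ zip t f))
    ≡⟨ cong (X +_) (∑-cong R λ w → ∑-insertions-zip R (G ∘ ((y , w) ∷_)) x s) ⟩
  X + (∑[ w ∈ R ] ∑[ v ∈ R ] Y v w)
    ≡⟨ cong (X +_) (∑-swap _ R R) ⟩
  X + (∑[ v ∈ R ] ∑[ w ∈ R ] Y v w)
    ≡⟨ ∑-+ _ _ R ⟨
  (∑[ v ∈ R ] ((∑[ f ∈ seqs R (suc (length s)) ] G ((x , v) ∷ zip (y ∷ s) f)) + (∑[ w ∈ R ] Y v w)))
    ≡⟨ ∑-cong R (λ v → cong (_+ (∑[ w ∈ R ] Y v w)) (∑-seqs R (length s) _)) ⟩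
  (∑[ v ∈ R ] ((∑[ w ∈ R ] ∑[ f ∈ seqs R (length s) ] G ((x , v) ∷ (y , w) ∷ zip s f)) + (∑[ w ∈ R ] Y v w)))
    ≡⟨ ∑-cong R (λ v → sym (∑-+ _ _ R)) ⟩
  (∑[ v ∈ R ] ∑[ w ∈ R ] ((∑[ f ∈ seqs R (length s) ] G ((x , v) ∷ (y , w) ∷ zip s f)) + Y v w))
    ≡⟨ ∑-cong R (λ v → ∑-cong R λ w → sym (∑-+ _ _ (seqs R (length s)))) ⟩
  (∑[ v ∈ R ] ∑[ w ∈ R ] ∑[ f ∈ seqs R (length s) ]
     (G ((x , v) ∷ (y , w) ∷ zip s f) + (∑[ z ∈ insertions (x , v) (zip s f) ] G ((y , w) ∷ z))))
    ≡⟨ ∑-cong R (λ v → ∑-cong R λ w → ∑-cong (seqs R (length s)) λ f →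
         cong (G ((x , v) ∷ (y , w) ∷ zip s f) +_)
              (sym (∑-map G ((y , w) ∷_) (insertions (x , v) (zip s f))))) ⟩
  (∑[ v ∈ R ] ∑[ w ∈ R ] ∑[ f ∈ seqs R (length s) ] ∑ (insertions (x , v) (zip (y ∷ s) (w ∷ f))) G)
    ≡⟨ ∑-cong R (λ v → sym (∑-seqs R (length s) _)) ⟩
  (∑[ v ∈ R ] ∑[ f ∈ seqs R (suc (length s)) ] ∑ (insertions (x , v) (zip (y ∷ s) f)) G) ∎
  where
  -- `X` collects the lists with `x` in front, `Y v w` those that begin with `(y , w)`.
  X : ℕ
  X = ∑[ v ∈ R ] ∑[ f ∈ seqs R (suc (length s)) ] G ((x , v) ∷ zip (y ∷ s) f)
  Y : _ → _ → ℕ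
  Y v w = ∑[ f ∈ seqs R (length s) ] ∑[ z ∈ insertions (x , v) (zip s f) ] G ((y , w) ∷ z)

≤ᵇ-suc : ∀ m n → (suc m ≤ᵇ suc n) ≡ (m ≤ᵇ n)
≤ᵇ-suc zero    n = refl
≤ᵇ-suc (suc m) n = refl

≤ᵇ∧≢ᵇ : ∀ m n → (m ≤ᵇ n) ∧ not (m ≡ᵇ n) ≡ not (n ≤ᵇ m)
≤ᵇ∧≢ᵇ zero    zero    = refl
≤ᵇ∧≢ᵇ zero    (suc n) = refl
≤ᵇ∧≢ᵇ (suc m) zero    = refl
≤ᵇ∧≢ᵇ (suc m) (suc n) rewrite ≤ᵇ-suc m n | ≤ᵇ-suc n m = ≤ᵇ∧≢ᵇ m n

≤ᵇ-sound : ∀ m n → (m ≤ᵇ n) ≡ true → m ≤ n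
≤ᵇ-sound m n eq = ≤ᵇ⇒≤ m n (Equivalence.from T-≡ eq)

≤ᵇ-complete : ∀ {m n} → m ≤ n → (m ≤ᵇ n) ≡ true
≤ᵇ-complete m≤n = Equivalence.to T-≡ (≤⇒≤ᵇ m≤n)

∧-trueˡ : ∀ {a b} → a ∧ b ≡ true → a ≡ true
∧-trueˡ {true} _ = refl

∧-trueʳ : ∀ {a b} → a ∧ b ≡ true → b ≡ true
∧-trueʳ {true} eq = eq

-- The test applied by `isPartitionᵇ` to two places of a chain: `isPartitionᵇ s f` is
-- `pairwiseᵇ _≺ᵇ_ (zip s f)` by definition.
_≺ᵇ_ : NN × ℕ → NN × ℕ → Bool
p ≺ᵇ q = (proj₂ p ≤ᵇ proj₂ q) ∧ (not (proj₂ p ≡ᵇ proj₂ q) ∨ (proj₁ p <γᵇ proj₁ q))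

-- Both Boolean comparisons are recorded because the larger element may be tested on either side of
-- the smaller one.
record _⋗_ (x y : NN) : Set where
  constructor _,_
  field
    gt  : (y <NNᵇ x) ≡ true
    ¬lt : (x <NNᵇ y) ≡ false

-- Ties go in front: elements are inserted in decreasing order, and γ reverses the order of N_N.
insert : A × ℕ → List (A × ℕ) → List (A × ℕ)
insert p []       = p ∷ []
insert p (q ∷ zs) = if proj₂ p ≤ᵇ proj₂ q then p ∷ q ∷ zs else q ∷ insert p zs

-- The larger element has the smaller label, so a tie is allowed if it comes first and forbidden if
-- it comes second. Hence for any two values exactly one of the two orders is admissible.
≺ᵇ-⋗ : ∀ {x y} v w → x ⋗ y → ((x , v) ≺ᵇ (y , w)) ≡ (v ≤ᵇ w)
≺ᵇ-⋗ v w (y<x , _) rewrite y<x | ∨-zeroʳ (not (v ≡ᵇ w)) = ∧-identityʳ _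

≺ᵇ-⋖ : ∀ {x y} v w → x ⋗ y → ((y , w) ≺ᵇ (x , v)) ≡ not (v ≤ᵇ w)
≺ᵇ-⋖ v w (_ , x≮y) rewrite x≮y | ∨-identityʳ (not (w ≡ᵇ v)) = ≤ᵇ∧≢ᵇ w v

-- Since `x` has a smaller label than every element of `zs`, only the values matter, and these
-- satisfy `v ≤ w ≤ w′`.
≺ᵇ-all : ∀ {x} v y w {zs} → (v ≤ᵇ w) ≡ true → All (λ q → x ⋗ proj₁ q) zs →
  all ((y , w) ≺ᵇ_) zs ≡ true → all ((x , v) ≺ᵇ_) zs ≡ true
≺ᵇ-all v y w                     v≤w []           _  = refl
≺ᵇ-all v y w {(y′ , w′) ∷ zs} v≤w (x⋗y ∷ x⋗zs) eq =
  cong₂ _∧_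
    (trans (≺ᵇ-⋗ v w′ x⋗y)
           (≤ᵇ-complete (≤-trans (≤ᵇ-sound v w v≤w) (≤ᵇ-sound w w′ (∧-trueˡ (∧-trueˡ {(y , w) ≺ᵇ (y′ , w′)} eq))))))
    (≺ᵇ-all v y w v≤w x⋗zs (∧-trueʳ {(y , w) ≺ᵇ (y′ , w′)} eq))

-- In an admissible chain, the new largest element fits only in front of the first entry of value at
-- least `v`. Further left it would precede a smaller value; further right it would follow a larger
-- value, or an equal one with larger label.
∑-insertions-sorted : ∀ (F : List (NN × ℕ) → ℕ) x v zs → All (λ q → x ⋗ proj₁ q) zs →
  (∑[ z ∈ insertions (x , v) zs ] ⟦ pairwiseᵇ _≺ᵇ_ z ⟧ * F z) ≡
  ⟦ pairwiseᵇ _≺ᵇ_ zs ⟧ * F (insert (x , v) zs)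
∑-insertions-sorted F x v []             _            = +-identityʳ _
∑-insertions-sorted F x v ((y , w) ∷ zs) (x⋗y ∷ x⋗zs) = begin
  ⟦ all (p ≺ᵇ_) (q ∷ zs) ∧ S (q ∷ zs) ⟧ * F (p ∷ q ∷ zs)
    + ∑ (map (q ∷_) (insertions p zs)) (λ z → ⟦ S z ⟧ * F z)
    ≡⟨ cong₂ _+_ refl (trans (∑-map _ (q ∷_) (insertions p zs)) tail-sum) ⟩
  ⟦ all (p ≺ᵇ_) (q ∷ zs) ∧ S (q ∷ zs) ⟧ * F (p ∷ q ∷ zs)
    + ⟦ (q ≺ᵇ p) ∧ all (q ≺ᵇ_) zs ⟧ * (⟦ S zs ⟧ * F (q ∷ insert p zs))
    ≡⟨ cong₂ (λ a b → ⟦ (a ∧ all (p ≺ᵇ_) zs) ∧ S (q ∷ zs) ⟧ * F (p ∷ q ∷ zs)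
         + ⟦ b ∧ all (q ≺ᵇ_) zs ⟧ * (⟦ S zs ⟧ * F (q ∷ insert p zs)))
         (≺ᵇ-⋗ v w x⋗y) (≺ᵇ-⋖ v w x⋗y) ⟩
  ⟦ ((v ≤ᵇ w) ∧ all (p ≺ᵇ_) zs) ∧ S (q ∷ zs) ⟧ * F (p ∷ q ∷ zs)
    + ⟦ not (v ≤ᵇ w) ∧ all (q ≺ᵇ_) zs ⟧ * (⟦ S zs ⟧ * F (q ∷ insert p zs))
    ≡⟨ decide ⟩
  ⟦ S (q ∷ zs) ⟧ * F (insert p (q ∷ zs)) ∎
  where
  p = (x , v)
  q = (y , w)
  S = pairwiseᵇ _≺ᵇ_

  tail-sum : (∑[ z ∈ insertions p zs ] ⟦ S (q ∷ z) ⟧ * F (q ∷ z)) ≡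
             ⟦ (q ≺ᵇ p) ∧ all (q ≺ᵇ_) zs ⟧ * (⟦ S zs ⟧ * F (q ∷ insert p zs))
  tail-sum = begin
    (∑[ z ∈ insertions p zs ] ⟦ all (q ≺ᵇ_) z ∧ S z ⟧ * F (q ∷ z))
      ≡⟨ ∑-cong-local (All.map (λ {z} eq → trans
           (cong (λ b → ⟦ b ∧ S z ⟧ * F (q ∷ z)) eq)
           (trans (cong (_* F (q ∷ z)) (⟦∧⟧ c (S z))) (*-assoc ⟦ c ⟧ ⟦ S z ⟧ _)))
           (all-insertions (q ≺ᵇ_) p zs)) ⟩
    (∑[ z ∈ insertions p zs ] ⟦ c ⟧ * (⟦ S z ⟧ * F (q ∷ z)))
      ≡⟨ ∑-*ˡ ⟦ c ⟧ _ (insertions p zs) ⟩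
    ⟦ c ⟧ * (∑[ z ∈ insertions p zs ] ⟦ S z ⟧ * F (q ∷ z))
      ≡⟨ cong (⟦ c ⟧ *_) (∑-insertions-sorted (F ∘ (q ∷_)) x v zs x⋗zs) ⟩
    ⟦ c ⟧ * (⟦ S zs ⟧ * F (q ∷ insert p zs)) ∎
    where c = (q ≺ᵇ p) ∧ all (q ≺ᵇ_) zs

  decide : ⟦ ((v ≤ᵇ w) ∧ all (p ≺ᵇ_) zs) ∧ S (q ∷ zs) ⟧ * F (p ∷ q ∷ zs)
    + ⟦ not (v ≤ᵇ w) ∧ all (q ≺ᵇ_) zs ⟧ * (⟦ S zs ⟧ * F (q ∷ insert p zs)) ≡
    ⟦ S (q ∷ zs) ⟧ * F (insert p (q ∷ zs))
  -- One summand survives: `p` must precede `q` if `v ≤ w` and follow it otherwise.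
  decide with v ≤ᵇ w in v≤w
  ... | true  = trans (+-identityʳ _) (cong (λ b → ⟦ b ⟧ * F (p ∷ q ∷ zs)) absorb)
    where
    absorb : all (p ≺ᵇ_) zs ∧ S (q ∷ zs) ≡ S (q ∷ zs)
    -- If `q` fails against `zs`, both sides are false; if not, `p` passes by transitivity through
    -- `q`.
    absorb with all (q ≺ᵇ_) zs in q≺zs
    ... | false = ∧-zeroʳ (all (p ≺ᵇ_) zs)
    ... | true  = cong (_∧ S zs) (≺ᵇ-all v y w v≤w x⋗zs q≺zs)
  ... | false = begin
    ⟦ all (q ≺ᵇ_) zs ⟧ * (⟦ S zs ⟧ * F (q ∷ insert p zs))  ≡⟨ *-assoc ⟦ all (q ≺ᵇ_) zs ⟧ _ _ ⟨
    ⟦ all (q ≺ᵇ_) zs ⟧ * ⟦ S zs ⟧ * F (q ∷ insert p zs)    ≡⟨ cong (_* F (q ∷ insert p zs)) (⟦∧⟧ (all (q ≺ᵇ_) zs) (S zs)) ⟨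
    ⟦ all (q ≺ᵇ_) zs ∧ S zs ⟧ * F (q ∷ insert p zs)        ∎

sortRows : List (A × ℕ) → List (A × ℕ)
sortRows = foldr insert []

All-zip : ∀ {P : A → Set} {xs} → All P xs → (ys : List B) → All (P ∘ proj₁) (zip xs ys)
All-zip []         ys       = []
All-zip (px ∷ pxs) []       = []
All-zip (px ∷ pxs) (y ∷ ys) = px ∷ All-zip pxs ys

-- The weight is arbitrary because the induction hypothesis is applied to `F ∘ insert (x , v)`. On
-- the left f is indexed by places of the chain `s`, on the right g by the fixed list `E`.
∑-perms-sorted : ∀ (R : List ℕ) (F : List (NN × ℕ) → ℕ) {E} → AllPairs _⋗_ E →
  (∑[ s ∈ perms E ] ∑[ f ∈ seqs R (length s) ] ⟦ pairwiseᵇ _≺ᵇ_ (zip s f) ⟧ * F (zip s f)) ≡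
  (∑[ g ∈ seqs R (length E) ] F (sortRows (zip E g)))
∑-perms-sorted R F []                        =
  trans (+-identityʳ _) (cong (_+ 0) (*-identityˡ (F [])))
∑-perms-sorted R F {x ∷ E} (x⋗E ∷ E↘) = begin
  (∑[ s ∈ perms (x ∷ E) ] ∑[ f ∈ seqs R (length s) ] G (zip s f))
    ≡⟨ ∑-concatMap _ (insertions x) (perms E) ⟩
  (∑[ s ∈ perms E ] ∑[ t ∈ insertions x s ] ∑[ f ∈ seqs R (length t) ] G (zip t f))
    ≡⟨ ∑-cong (perms E) (∑-insertions-zip R G x) ⟩
  (∑[ s ∈ perms E ] ∑[ v ∈ R ] ∑[ f ∈ seqs R (length s) ] ∑ (insertions (x , v) (zip s f)) G)
    ≡⟨ ∑-cong-local (All.map (λ {s} x⋗s → ∑-cong R λ v → ∑-cong (seqs R (length s)) λ f →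
         ∑-insertions-sorted F x v (zip s f) (All-zip x⋗s f)) (All-perms x⋗E)) ⟩
  (∑[ s ∈ perms E ] ∑[ v ∈ R ] ∑[ f ∈ seqs R (length s) ] ⟦ S (zip s f) ⟧ * F (insert (x , v) (zip s f)))
    ≡⟨ ∑-swap _ (perms E) R ⟩
  (∑[ v ∈ R ] ∑[ s ∈ perms E ] ∑[ f ∈ seqs R (length s) ] ⟦ S (zip s f) ⟧ * F (insert (x , v) (zip s f)))
    ≡⟨ ∑-cong R (λ v → ∑-perms-sorted R (F ∘ insert (x , v)) E↘) ⟩
  (∑[ v ∈ R ] ∑[ g ∈ seqs R (length E) ] F (insert (x , v) (sortRows (zip E g))))
    ≡⟨ ∑-seqs R (length E) _ ⟨
  (∑[ g ∈ seqs R (length (x ∷ E)) ] F (sortRows (zip (x ∷ E) g))) ∎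
  where
  S = pairwiseᵇ _≺ᵇ_
  G : List (NN × ℕ) → ℕ
  G z = ⟦ S z ⟧ * F z

-- Matrices as maps from columns to rows

unit : ℕ → ℕ → ℕ → List ℕ
unit zero    i       a = []
unit (suc L) zero    a = a ∷ replicate L 0
unit (suc L) (suc i) a = 0 ∷ unit L i a

length-unit : ∀ L i a → length (unit L i a) ≡ L
length-unit zero    i       a = refl
length-unit (suc L) zero    a = cong suc (length-replicate L)
length-unit (suc L) (suc i) a = cong suc (length-unit L i a)

matrix : ℕ → List (ℕ × ℕ) → List (List ℕ)
matrix L = foldr (λ (a , i) → zipWith _∷_ (unit L i a)) (replicate L [])

length-matrix : ∀ L z → length (matrix L z) ≡ L
length-matrix L []            = length-replicate L
length-matrix L ((a , i) ∷ z) = begin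
  length (zipWith _∷_ (unit L i a) (matrix L z)) ≡⟨ length-zipWith _∷_ (unit L i a) (matrix L z) ⟩
  length (unit L i a) ⊓ length (matrix L z)      ≡⟨ cong₂ _⊓_ (length-unit L i a) (length-matrix L z) ⟩
  L ⊓ L                                          ≡⟨ ⊓-idem L ⟩
  L                                              ∎

-- Once the single nonzero entry has been met, the rest of the column vanishes, which is expressed
-- by its sum. `b` stands for the test of that entry, which `columnOKᵇ` places between the two
-- conditions on `c`.
columnOKᵇ-suc : ∀ b a c →
  (countᵇ nonzeroᵇ c ≡ᵇ 0) ∧ (b ∧ all (λ x → (x ≡ᵇ 0) ∨ (x ≡ᵇ a)) c) ≡ b ∧ (sum c ≡ᵇ 0)
columnOKᵇ-suc b a []          = refl
columnOKᵇ-suc b a (zero ∷ c)  = columnOKᵇ-suc b a c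
columnOKᵇ-suc b a (suc x ∷ c) = sym (∧-zeroʳ b)

-- A first entry zero leaves a shorter column of the same kind; a nonzero one must be `a` with zeros
-- below it. The bound `a ≤ n` ensures that `a` is among the enumerated entries.
∑-columnOK : ∀ (H : List ℕ → ℕ) L {a n} → 0 < a → a ≤ n →
  (∑[ c ∈ seqs (upTo (suc n)) L ] ⟦ columnOKᵇ c a ⟧ * H c) ≡ (∑[ i ∈ upTo L ] H (unit L i a))
∑-columnOK H zero    _ _ = refl
∑-columnOK H (suc L) {suc a} {n} 0<a a<n = begin
  (∑[ c ∈ seqs V (suc L) ] ⟦ columnOKᵇ c (suc a) ⟧ * H c)
    ≡⟨ ∑-seqs V L _ ⟩
  (∑[ x ∈ V ] ∑[ c ∈ seqs V L ] ⟦ columnOKᵇ (x ∷ c) (suc a) ⟧ * H (x ∷ c))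
    ≡⟨ ∑-upTo-suc _ n ⟩
  (∑[ c ∈ seqs V L ] ⟦ columnOKᵇ c (suc a) ⟧ * H (0 ∷ c)) +
  (∑[ x ∈ upTo n ] ∑[ c ∈ seqs V L ] ⟦ columnOKᵇ (suc x ∷ c) (suc a) ⟧ * H (suc x ∷ c))
    ≡⟨ cong₂ _+_ (∑-columnOK (H ∘ (0 ∷_)) L 0<a a<n)
         (∑-cong (upTo n) λ x → trans (∑-cong (seqs V L) (split x)) (∑-*ˡ ⟦ x ≡ᵇ a ⟧ _ (seqs V L))) ⟩
  below +
  (∑[ x ∈ upTo n ] ⟦ x ≡ᵇ a ⟧ * (∑[ c ∈ seqs V L ] ⟦ sum c ≡ᵇ 0 ⟧ * H (suc x ∷ c)))
    ≡⟨ cong (below +_) (∑-δ _ a<n) ⟩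
  below + (∑[ c ∈ seqs V L ] ⟦ sum c ≡ᵇ 0 ⟧ * H (suc a ∷ c))
    ≡⟨ cong (below +_) (∑-seqs-zero n L _) ⟩
  below + H (unit (suc L) 0 (suc a))
    ≡⟨ +-comm below _ ⟩
  H (unit (suc L) 0 (suc a)) + below
    ≡⟨ ∑-upTo-suc _ L ⟨
  (∑[ i ∈ upTo (suc L) ] H (unit (suc L) i (suc a))) ∎
  where
  V = upTo (suc n)
  below = ∑[ i ∈ upTo L ] H (0 ∷ unit L i (suc a))

  split : ∀ x c → ⟦ columnOKᵇ (suc x ∷ c) (suc a) ⟧ * H (suc x ∷ c) ≡
                  ⟦ x ≡ᵇ a ⟧ * (⟦ sum c ≡ᵇ 0 ⟧ * H (suc x ∷ c))
  split x c = begin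
    ⟦ columnOKᵇ (suc x ∷ c) (suc a) ⟧ * H (suc x ∷ c)
      ≡⟨ cong (λ b → ⟦ b ⟧ * H (suc x ∷ c)) (columnOKᵇ-suc (x ≡ᵇ a) (suc a) c) ⟩
    ⟦ (x ≡ᵇ a) ∧ (sum c ≡ᵇ 0) ⟧ * H (suc x ∷ c)
      ≡⟨ cong (_* H (suc x ∷ c)) (⟦∧⟧ (x ≡ᵇ a) (sum c ≡ᵇ 0)) ⟩
    ⟦ x ≡ᵇ a ⟧ * ⟦ sum c ≡ᵇ 0 ⟧ * H (suc x ∷ c)
      ≡⟨ *-assoc ⟦ x ≡ᵇ a ⟧ _ _ ⟩
    ⟦ x ≡ᵇ a ⟧ * (⟦ sum c ≡ᵇ 0 ⟧ * H (suc x ∷ c)) ∎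

-- Matrices are enumerated by rows, but condition (2) concerns columns; splitting off the first
-- column makes (2) accessible to induction.
∑-columns : ∀ (V : List A) k L (G : List (List A) → ℕ) →
  ∑ (seqs (seqs V (suc k)) L) G ≡
  (∑[ c ∈ seqs V L ] ∑[ m ∈ seqs (seqs V k) L ] G (zipWith _∷_ c m))
∑-columns V k zero    G = sym (+-identityʳ _)
∑-columns V k (suc L) G = begin
  ∑ (seqs (seqs V (suc k)) (suc L)) G
    ≡⟨ ∑-seqs (seqs V (suc k)) L G ⟩
  (∑[ r ∈ seqs V (suc k) ] ∑[ m ∈ seqs (seqs V (suc k)) L ] G (r ∷ m))
    ≡⟨ ∑-seqs V k _ ⟩
  (∑[ x ∈ V ] ∑[ r ∈ seqs V k ] ∑[ m ∈ seqs (seqs V (suc k)) L ] G ((x ∷ r) ∷ m))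
    ≡⟨ ∑-cong V (λ x → ∑-cong (seqs V k) λ r → ∑-columns V k L _) ⟩
  (∑[ x ∈ V ] ∑[ r ∈ seqs V k ] ∑[ c ∈ seqs V L ] ∑[ m ∈ seqs (seqs V k) L ]
     G ((x ∷ r) ∷ zipWith _∷_ c m))
    ≡⟨ ∑-cong V (λ x → ∑-swap _ (seqs V k) (seqs V L)) ⟩
  (∑[ x ∈ V ] ∑[ c ∈ seqs V L ] ∑[ r ∈ seqs V k ] ∑[ m ∈ seqs (seqs V k) L ]
     G ((x ∷ r) ∷ zipWith _∷_ c m))
    ≡⟨ ∑-cong V (λ x → ∑-cong (seqs V L) λ c → sym (∑-seqs (seqs V k) L _)) ⟩
  (∑[ x ∈ V ] ∑[ c ∈ seqs V L ] ∑[ m ∈ seqs (seqs V k) (suc L) ] G (zipWith _∷_ (x ∷ c) m))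
    ≡⟨ ∑-seqs V L _ ⟨
  (∑[ c ∈ seqs V (suc L) ] ∑[ m ∈ seqs (seqs V k) (suc L) ] G (zipWith _∷_ c m)) ∎

columns-zipWith : ∀ k c m → length c ≡ length m → columns (suc k) (zipWith _∷_ c m) ≡ c ∷ columns k m
columns-zipWith k c m eq = begin
  map (λ j → map (λ row → nth row j) (zipWith _∷_ c m)) (upTo (suc k))
    ≡⟨ cong (map _) (upTo-suc k) ⟩
  map (λ row → nth row 0) (zipWith _∷_ c m)
    ∷ map (λ j → map (λ row → nth row j) (zipWith _∷_ c m)) (map suc (upTo k))
    ≡⟨ cong₂ _∷_ (heads c m eq) (sym (map-∘ (upTo k))) ⟩
  c ∷ map (λ j → map (λ row → nth row (suc j)) (zipWith _∷_ c m)) (upTo k)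
    ≡⟨ cong (c ∷_) (map-cong (λ j → tails j c m eq) (upTo k)) ⟩
  c ∷ columns k m ∎
  where
  heads : ∀ c m → length c ≡ length m → map (λ row → nth row 0) (zipWith _∷_ c m) ≡ c
  heads []      []      _  = refl
  heads (x ∷ c) (r ∷ m) eq = cong (x ∷_) (heads c m (suc-injective eq))

  tails : ∀ j c m → length c ≡ length m →
    map (λ row → nth row (suc j)) (zipWith _∷_ c m) ≡ map (λ row → nth row j) m
  tails j []      []      _  = refl
  tails j (x ∷ c) (r ∷ m) eq = cong (nth r j ∷_) (tails j c m (suc-injective eq))

∑-seqs-singleton : ∀ (x : A) k (f : List A → ℕ) → ∑ (seqs (x ∷ []) k) f ≡ f (replicate k x)
∑-seqs-singleton x zero    f = +-identityʳ _
∑-seqs-singleton x (suc k) f = begin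
  ∑ (seqs (x ∷ []) (suc k)) f            ≡⟨ ∑-seqs (x ∷ []) k f ⟩
  ∑ (seqs (x ∷ []) k) (f ∘ (x ∷_)) + 0   ≡⟨ +-identityʳ _ ⟩
  ∑ (seqs (x ∷ []) k) (f ∘ (x ∷_))       ≡⟨ ∑-seqs-singleton x k _ ⟩
  f (replicate (suc k) x)                ∎

-- Condition (2) leaves only the choice of one row in each column; columns already chosen are
-- absorbed into `G`.
∑-matrices : ∀ (G : List (List ℕ) → ℕ) L n {as} → All (λ a → 0 < a × a ≤ n) as →
  (∑[ m ∈ seqs (seqs (upTo (suc n)) (length as)) L ]
     ⟦ and (zipWith columnOKᵇ (columns (length as) m) as) ⟧ * G m) ≡
  (∑[ g ∈ seqs (upTo L) (length as) ] G (matrix L (zip as g)))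
∑-matrices G L n []                     = begin
  (∑[ m ∈ seqs ([] ∷ []) L ] 1 * G m) ≡⟨ ∑-seqs-singleton [] L _ ⟩
  1 * G (replicate L [])              ≡⟨ *-identityˡ _ ⟩
  G (replicate L [])                  ≡⟨ +-identityʳ _ ⟨
  G (replicate L []) + 0              ∎
∑-matrices G L n {a ∷ as} ((0<a , a≤n) ∷ bounds) = begin
  (∑[ m ∈ seqs (seqs V (suc k)) L ] ⟦ ok (a ∷ as) m ⟧ * G m)
    ≡⟨ ∑-columns V k L _ ⟩
  (∑[ c ∈ seqs V L ] ∑[ m ∈ seqs (seqs V k) L ] ⟦ ok (a ∷ as) (zipWith _∷_ c m) ⟧ * G (zipWith _∷_ c m))
    -- `zipWith` truncates, so `c` can be recovered as the first column only because `c` and `m`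
    -- both have length `L`.
    ≡⟨ ∑-cong-local (All.map (λ {c} |c| → ∑-cong-local (All.map (λ {m} |m| →
         split c m (trans |c| (sym |m|))) (seqs-length (seqs V k) L))) (seqs-length V L)) ⟩
  (∑[ c ∈ seqs V L ] ∑[ m ∈ seqs (seqs V k) L ] ⟦ columnOKᵇ c a ⟧ * (⟦ ok as m ⟧ * G (zipWith _∷_ c m)))
    ≡⟨ ∑-cong (seqs V L) (λ c → ∑-*ˡ ⟦ columnOKᵇ c a ⟧ _ (seqs (seqs V k) L)) ⟩
  (∑[ c ∈ seqs V L ] ⟦ columnOKᵇ c a ⟧ * (∑[ m ∈ seqs (seqs V k) L ] ⟦ ok as m ⟧ * G (zipWith _∷_ c m)))
    ≡⟨ ∑-cong (seqs V L) (λ c → cong (⟦ columnOKᵇ c a ⟧ *_) (∑-matrices _ L n bounds)) ⟩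
  (∑[ c ∈ seqs V L ] ⟦ columnOKᵇ c a ⟧ * (∑[ g ∈ seqs (upTo L) k ] G (zipWith _∷_ c (matrix L (zip as g)))))
    ≡⟨ ∑-columnOK _ L 0<a a≤n ⟩
  (∑[ i ∈ upTo L ] ∑[ g ∈ seqs (upTo L) k ] G (matrix L (zip (a ∷ as) (i ∷ g))))
    ≡⟨ ∑-seqs (upTo L) k _ ⟨
  (∑[ g ∈ seqs (upTo L) (suc k) ] G (matrix L (zip (a ∷ as) g))) ∎
  where
  V = upTo (suc n)
  k = length as
  ok : List ℕ → List (List ℕ) → Bool
  ok as m = and (zipWith columnOKᵇ (columns (length as) m) as)

  split : ∀ c m → length c ≡ length m →
    ⟦ ok (a ∷ as) (zipWith _∷_ c m) ⟧ * G (zipWith _∷_ c m) ≡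
    ⟦ columnOKᵇ c a ⟧ * (⟦ ok as m ⟧ * G (zipWith _∷_ c m))
  split c m eq = begin
    ⟦ ok (a ∷ as) (zipWith _∷_ c m) ⟧ * G (zipWith _∷_ c m)
      ≡⟨ cong (λ cs → ⟦ and (zipWith columnOKᵇ cs (a ∷ as)) ⟧ * G (zipWith _∷_ c m)) (columns-zipWith k c m eq) ⟩
    ⟦ columnOKᵇ c a ∧ ok as m ⟧ * G (zipWith _∷_ c m)
      ≡⟨ cong (_* G (zipWith _∷_ c m)) (⟦∧⟧ (columnOKᵇ c a) (ok as m)) ⟩
    ⟦ columnOKᵇ c a ⟧ * ⟦ ok as m ⟧ * G (zipWith _∷_ c m)
      ≡⟨ *-assoc ⟦ columnOKᵇ c a ⟧ _ _ ⟩
    ⟦ columnOKᵇ c a ⟧ * (⟦ ok as m ⟧ * G (zipWith _∷_ c m)) ∎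

-- Reading words

-- The reading word with every entry tagged by its row, counted from `k`. Concatenation alone
-- forgets the rows, by which `insert` finds the place of an entry.
label : ℕ → List (List A) → List (A × ℕ)
label k []       = []
label k (r ∷ rs) = map (_, k) r ++ label (suc k) rs

map-proj₁-label : ∀ k (rs : List (List A)) → map proj₁ (label k rs) ≡ concat rs
map-proj₁-label k []       = refl
map-proj₁-label k (r ∷ rs) = begin
  map proj₁ (map (_, k) r ++ label (suc k) rs)          ≡⟨ map-++ proj₁ (map (_, k) r) _ ⟩
  map proj₁ (map (_, k) r) ++ map proj₁ (label (suc k) rs)
    ≡⟨ cong₂ _++_ (trans (sym (map-∘ r)) (map-id r)) (map-proj₁-label (suc k) rs) ⟩
  r ++ concat rs ∎

label-lower : ∀ k (rs : List (List A)) → All (λ q → k ≤ proj₂ q) (label k rs)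
label-lower k []       = []
label-lower k (r ∷ rs) =
  All.++⁺ (All.map⁺ (All.universal (λ _ → ≤-refl) r))
          (All.map (≤-trans (n≤1+n k)) (label-lower (suc k) rs))

insert-lower : ∀ (a : A) v {zs} → All (λ q → v ≤ proj₂ q) zs → insert (a , v) zs ≡ (a , v) ∷ zs
insert-lower a v []                                  = refl
insert-lower a v (v≤w ∷ _) rewrite ≤ᵇ-complete v≤w = refl

≤ᵇ-+suc : ∀ k i → (k + suc i ≤ᵇ k) ≡ false
≤ᵇ-+suc zero    i = refl
≤ᵇ-+suc (suc k) i = trans (≤ᵇ-suc (k + suc i) k) (≤ᵇ-+suc k i)

insert-++ : ∀ (a : A) k i r zs →
  insert (a , k + suc i) (map (_, k) r ++ zs) ≡ map (_, k) r ++ insert (a , k + suc i) zs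
insert-++ a k i []      zs = refl
insert-++ a k i (x ∷ r) zs rewrite ≤ᵇ-+suc k i = cong ((x , k) ∷_) (insert-++ a k i r zs)

nonzeros : List ℕ → List ℕ
nonzeros = filterᵇ nonzeroᵇ

nonzeros-zeros : ∀ m → map nonzeros (zipWith _∷_ (replicate (length m) 0) m) ≡ map nonzeros m
nonzeros-zeros []      = refl
nonzeros-zeros (r ∷ m) = cong (nonzeros r ∷_) (nonzeros-zeros m)

-- The entry of a new leftmost column comes after all rows above it and before the rest of its own
-- row, which is where `insert` puts it, ties going in front. Positivity of `a` keeps `nonzeros`
-- from dropping it.
label-unit : ∀ k m {i a} → 0 < a → i < length m →
  label k (map nonzeros (zipWith _∷_ (unit (length m) i a) m)) ≡
  insert (a , k + i) (label k (map nonzeros m))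
label-unit k (r ∷ m) {zero}  {suc a} 0<a i<L = begin
  (suc a , k) ∷ map (_, k) (nonzeros r)
    ++ label (suc k) (map nonzeros (zipWith _∷_ (replicate (length m) 0) m))
    ≡⟨ cong (λ t → (suc a , k) ∷ map (_, k) (nonzeros r) ++ label (suc k) t) (nonzeros-zeros m) ⟩
  (suc a , k) ∷ label k (map nonzeros (r ∷ m))
    ≡⟨ insert-lower (suc a) k (label-lower k (map nonzeros (r ∷ m))) ⟨
  insert (suc a , k) (label k (map nonzeros (r ∷ m)))
    ≡⟨ cong (λ j → insert (suc a , j) (label k (map nonzeros (r ∷ m)))) (+-identityʳ k) ⟨
  insert (suc a , k + 0) (label k (map nonzeros (r ∷ m))) ∎
label-unit k (r ∷ m) {suc i} {a} 0<a (s≤s i<L) = begin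
  map (_, k) (nonzeros r) ++ label (suc k) (map nonzeros (zipWith _∷_ (unit (length m) i a) m))
    ≡⟨ cong (map (_, k) (nonzeros r) ++_) (label-unit (suc k) m 0<a i<L) ⟩
  map (_, k) (nonzeros r) ++ insert (a , suc k + i) (label (suc k) (map nonzeros m))
    ≡⟨ cong (λ j → map (_, k) (nonzeros r) ++ insert (a , j) (label (suc k) (map nonzeros m))) (+-suc k i) ⟨
  map (_, k) (nonzeros r) ++ insert (a , k + suc i) (label (suc k) (map nonzeros m))
    ≡⟨ insert-++ a k i (nonzeros r) _ ⟨
  insert (a , k + suc i) (label k (map nonzeros (r ∷ m))) ∎

label-matrix : ∀ L {z} → All (λ (a , i) → 0 < a × i < L) z →
  label 0 (map nonzeros (matrix L z)) ≡ sortRows z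
label-matrix L []                                    = empty 0 L
  where
  empty : ∀ k L → label k (map nonzeros (replicate L [])) ≡ []
  empty k zero    = refl
  empty k (suc L) = empty (suc k) L
label-matrix L {(a , i) ∷ z} ((0<a , i<L) ∷ bounds) = begin
  label 0 (map nonzeros (zipWith _∷_ (unit L i a) (matrix L z)))
    ≡⟨ cong (λ n → label 0 (map nonzeros (zipWith _∷_ (unit n i a) (matrix L z)))) (length-matrix L z) ⟨
  label 0 (map nonzeros (zipWith _∷_ (unit (length (matrix L z)) i a) (matrix L z)))
    ≡⟨ label-unit 0 (matrix L z) 0<a (subst (i <_) (sym (length-matrix L z)) i<L) ⟩
  insert (a , i) (label 0 (map nonzeros (matrix L z)))
    ≡⟨ cong (insert (a , i)) (label-matrix L bounds) ⟩
  sortRows ((a , i) ∷ z) ∎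

nonzeros-concat : ∀ m → nonzeros (concat m) ≡ concat (map nonzeros m)
nonzeros-concat []      = refl
nonzeros-concat (r ∷ m) = trans (filter-++ _ r (concat m)) (cong (nonzeros r ++_) (nonzeros-concat m))

reading-matrix : ∀ L {z} → All (λ (a , i) → 0 < a × i < L) z →
  nonzeros (concat (matrix L z)) ≡ map proj₁ (sortRows z)
reading-matrix L {z} bounds = begin
  nonzeros (concat (matrix L z))                   ≡⟨ nonzeros-concat (matrix L z) ⟩
  concat (map nonzeros (matrix L z))               ≡⟨ map-proj₁-label 0 (map nonzeros (matrix L z)) ⟨
  map proj₁ (label 0 (map nonzeros (matrix L z)))  ≡⟨ cong (map proj₁) (label-matrix L bounds) ⟩
  map proj₁ (sortRows z)                           ∎

-- Row sums as exponent vectors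

zipWith-+-zeros : ∀ xs → zipWith _+_ (replicate (length xs) 0) xs ≡ xs
zipWith-+-zeros []       = refl
zipWith-+-zeros (x ∷ xs) = cong (x ∷_) (zipWith-+-zeros xs)

-- expVec indexes the variables from 1, whereas rows are indexed from 0.
term : ℕ × ℕ → ℕ × ℕ
term (a , i) = (suc i , a)

expVec-∷ : ∀ L i a vw → expVec L ((suc i , a) ∷ vw) ≡ zipWith _+_ (unit L i a) (expVec L vw)
expVec-∷ L i a vw = begin
  map total (map suc (upTo L))
    ≡⟨ map-∘ (upTo L) ⟨
  map (total ∘ suc) (upTo L)
    ≡⟨ map-cong pointwise (upTo L) ⟩
  map (λ j → (if i ≡ᵇ j then a else 0) + rest (suc j)) (upTo L)
    ≡⟨ add-unit L i (rest ∘ suc) ⟩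
  zipWith _+_ (unit L i a) (map (rest ∘ suc) (upTo L))
    ≡⟨ cong (zipWith _+_ (unit L i a)) (map-∘ (upTo L)) ⟩
  zipWith _+_ (unit L i a) (expVec L vw) ∎
  where
  total rest : ℕ → ℕ
  total v = sum (map proj₂ (filterᵇ (λ p → proj₁ p ≡ᵇ v) ((suc i , a) ∷ vw)))
  rest  v = sum (map proj₂ (filterᵇ (λ p → proj₁ p ≡ᵇ v) vw))

  pointwise : ∀ j → total (suc j) ≡ (if i ≡ᵇ j then a else 0) + rest (suc j)
  pointwise j with i ≡ᵇ j
  ... | true  = refl
  ... | false = refl

  add-unit : ∀ L i (h : ℕ → ℕ) →
    map (λ j → (if i ≡ᵇ j then a else 0) + h j) (upTo L) ≡ zipWith _+_ (unit L i a) (map h (upTo L))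
  add-unit zero    i       h = refl
  -- The tail of `upTo (suc L)` computes to `applyUpTo suc L`; the rewrite turns it into
  -- `map suc (upTo L)`.
  add-unit (suc L) zero    h rewrite sym (map-applyUpTo id suc L) = cong (a + h 0 ∷_) (begin
    map (λ j → (if 0 ≡ᵇ j then a else 0) + h j) (map suc (upTo L))   ≡⟨ map-∘ (upTo L) ⟨
    map (h ∘ suc) (upTo L)
      ≡⟨ zipWith-+-zeros (map (h ∘ suc) (upTo L)) ⟨
    zipWith _+_ (replicate (length (map (h ∘ suc) (upTo L))) 0) (map (h ∘ suc) (upTo L))
      ≡⟨ cong₂ (λ n ys → zipWith _+_ (replicate n 0) ys)
           (trans (length-map (h ∘ suc) (upTo L)) (length-upTo L)) (map-∘ (upTo L)) ⟩
    zipWith _+_ (replicate L 0) (map h (map suc (upTo L)))           ∎)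
  add-unit (suc L) (suc i) h rewrite sym (map-applyUpTo id suc L) = cong (h 0 ∷_) (begin
    map (λ j → (if suc i ≡ᵇ j then a else 0) + h j) (map suc (upTo L))  ≡⟨ map-∘ (upTo L) ⟨
    map (λ j → (if i ≡ᵇ j then a else 0) + h (suc j)) (upTo L)          ≡⟨ add-unit L i (h ∘ suc) ⟩
    zipWith _+_ (unit L i a) (map (h ∘ suc) (upTo L))
      ≡⟨ cong (zipWith _+_ (unit L i a)) (map-∘ (upTo L)) ⟩
    zipWith _+_ (unit L i a) (map h (map suc (upTo L)))                 ∎)

expVec-[] : ∀ N → expVec N [] ≡ replicate N 0
expVec-[] N = trans (map-const 0 (range1 N))
  (cong (λ n → replicate n 0) (trans (length-map suc (upTo N)) (length-upTo N)))

rowSums-matrix : ∀ L z → map sum (matrix L z) ≡ expVec L (map term z)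
rowSums-matrix L []            = begin
  map sum (replicate L []) ≡⟨ map-replicate sum L [] ⟩
  replicate L 0            ≡⟨ expVec-[] L ⟨
  expVec L []              ∎
rowSums-matrix L ((a , i) ∷ z) = begin
  map sum (zipWith _∷_ (unit L i a) (matrix L z))
    ≡⟨ map-zipWith _∷_ sum (unit L i a) (matrix L z) ⟩
  zipWith (λ x r → x + sum r) (unit L i a) (matrix L z)
    ≡⟨ zipWith-map _+_ id sum (unit L i a) (matrix L z) ⟨
  zipWith _+_ (map id (unit L i a)) (map sum (matrix L z))
    ≡⟨ cong (λ u → zipWith _+_ u (map sum (matrix L z))) (map-id (unit L i a)) ⟩
  zipWith _+_ (unit L i a) (map sum (matrix L z))
    ≡⟨ cong (zipWith _+_ (unit L i a)) (rowSums-matrix L z) ⟩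
  zipWith _+_ (unit L i a) (expVec L (map term z))
    ≡⟨ expVec-∷ L i a (map term z) ⟨
  expVec L (map term ((a , i) ∷ z)) ∎

expVec-↭ : ∀ N {vw vw′} → vw ↭ vw′ → expVec N vw ≡ expVec N vw′
expVec-↭ N p = map-cong (λ v → sum-↭ (Perm.map⁺ proj₂ (filter-↭ _ p))) (range1 N)

insert-↭ : ∀ (p : A × ℕ) zs → insert p zs ↭ p ∷ zs
insert-↭ p []       = Perm.refl
insert-↭ p (q ∷ zs) with proj₂ p ≤ᵇ proj₂ q
... | true  = Perm.refl
... | false = Perm.trans (Perm.prep q (insert-↭ p zs)) (Perm.swap q p Perm.refl)

sortRows-↭ : ∀ (z : List (A × ℕ)) → sortRows z ↭ z
sortRows-↭ []      = Perm.refl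
sortRows-↭ (p ∷ z) = Perm.trans (insert-↭ p (sortRows z)) (Perm.prep p (sortRows-↭ z))

-- `insert` compares second components only. This is used to forget the index k of a_k and to shift
-- all values by one.
sortRows-map : ∀ (h : A × ℕ → B × ℕ) → (∀ p q → (proj₂ (h p) ≤ᵇ proj₂ (h q)) ≡ (proj₂ p ≤ᵇ proj₂ q)) →
  ∀ z → sortRows (map h z) ≡ map h (sortRows z)
sortRows-map h mono []      = refl
sortRows-map h mono (p ∷ z) = trans (cong (insert (h p)) (sortRows-map h mono z)) (insert-map (sortRows z))
  where
  insert-map : ∀ zs → insert (h p) (map h zs) ≡ map h (insert p zs)
  insert-map []       = refl
  insert-map (q ∷ zs) rewrite mono p q with proj₂ p ≤ᵇ proj₂ q
  ... | true  = refl
  ... | false = cong (h q ∷_) (insert-map zs)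

-- The elements of P^α̃

<⇒<ᵇ≡true : ∀ {m n} → m < n → (m <ᵇ n) ≡ true
<⇒<ᵇ≡true m<n = Equivalence.to T-≡ (<⇒<ᵇ m<n)

<⇒>ᵇ≡false : ∀ {m n} → m < n → (n <ᵇ m) ≡ false
<⇒>ᵇ≡false {zero}  {suc n} _           = refl
<⇒>ᵇ≡false {suc m} {suc n} (s≤s m<n) = <⇒>ᵇ≡false m<n

<⇒≡ᵇ≡false : ∀ {m n} → m < n → (n ≡ᵇ m) ≡ false
<⇒≡ᵇ≡false {zero}  {suc n} _           = refl
<⇒≡ᵇ≡false {suc m} {suc n} (s≤s m<n) = <⇒≡ᵇ≡false m<n

≡ᵇ-refl : ∀ n → (n ≡ᵇ n) ≡ true
≡ᵇ-refl n = Equivalence.to T-≡ (≡⇒≡ᵇ n n refl)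

≡ᵇ-sound : ∀ m n → (m ≡ᵇ n) ≡ true → m ≡ n
≡ᵇ-sound m n eq = ≡ᵇ⇒≡ m n (Equivalence.from T-≡ eq)

<ᵇ-irrefl : ∀ n → (n <ᵇ n) ≡ false
<ᵇ-irrefl zero    = refl
<ᵇ-irrefl (suc n) = <ᵇ-irrefl n

⋗-fst : ∀ {a b} → a < b → ∀ k l → (b , l) ⋗ (a , k)
⋗-fst {a} {b} a<b k l
  = cong (_∨ ((a ≡ᵇ b) ∧ (k <ᵇ l))) (<⇒<ᵇ≡true a<b)
  , cong₂ (λ x y → x ∨ (y ∧ (l <ᵇ k))) (<⇒>ᵇ≡false a<b) (<⇒≡ᵇ≡false a<b)

⋗-snd : ∀ a {k l} → k < l → (a , l) ⋗ (a , k)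
⋗-snd a {k} {l} k<l
  = cong₂ _∨_ (<ᵇ-irrefl a) (cong₂ _∧_ (≡ᵇ-refl a) (<⇒<ᵇ≡true k<l))
  , cong₂ _∨_ (<ᵇ-irrefl a) (cong₂ _∧_ (≡ᵇ-refl a) (<⇒>ᵇ≡false k<l))

⋗⇒≥ : ∀ {x y} → x ⋗ y → proj₁ y ≤ proj₁ x
⋗⇒≥ {b , l} {a , k} (y<x , _) = ≮⇒≥ λ b<a →
  case trans (sym y<x) (cong₂ (λ p q → p ∨ (q ∧ (k <ᵇ l))) (<⇒>ᵇ≡false b<a) (<⇒≡ᵇ≡false b<a)) of λ ()

range1-ascending : ∀ n → AllPairs _<_ (range1 n)
range1-ascending n = AllPairs.map⁺ (AllPairs.applyUpTo⁺₁ id n λ i<j _ → s≤s i<j)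

elemsP-ascending : ∀ α → AllPairs (flip _⋗_) (elemsP α)
elemsP-ascending α = AllPairs.concat⁺
  (All.map⁺ (All.universal (λ a → AllPairs.map⁺ (AllPairs.map (⋗-snd a) (range1-ascending (mult a α)))) _))
  (AllPairs.map⁺ (AllPairs.map
    (λ a<b → All.map⁺ (All.universal (λ k → All.map⁺ (All.universal (λ l → ⋗-fst a<b k l) _)) _))
    (range1-ascending (sum α))))

AllPairs-reverse : ∀ {R : A → A → Set} {xs} → AllPairs (flip R) xs → AllPairs R (reverse xs)
AllPairs-reverse                  []           = []
AllPairs-reverse {xs = x ∷ xs} (Rx ∷ Rxs) = subst (AllPairs _) (sym (unfold-reverse x xs))
  (AllPairs.++⁺ (AllPairs-reverse Rxs) ([] ∷ [])
    (All.map (_∷ []) (Perm.All-resp-↭ (↭-sym (↭-reverse xs)) Rx)))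

replicate-mult : ∀ a α → replicate (mult a α) a ≡ filterᵇ (a ≡ᵇ_) α
replicate-mult a []      = refl
replicate-mult a (x ∷ α) with a ≡ᵇ x in a≡x
... | true  = cong₂ _∷_ (≡ᵇ-sound a x a≡x) (replicate-mult a α)
... | false = replicate-mult a α

-- The block of `a` has as many elements as `α` has parts equal to `a`, so it can be written as a
-- filter of `α`; the filters can then be merged.
weights-elemsP : ∀ α → map wt (elemsP α) ≡ concatMap (λ a → filterᵇ (a ≡ᵇ_) α) (range1 (sum α))
weights-elemsP α = trans (map-concatMap wt _ (range1 (sum α))) (concatMap-cong block (range1 (sum α)))
  where
  block : ∀ a → map wt (map (a ,_) (range1 (mult a α))) ≡ filterᵇ (a ≡ᵇ_) α
  block a = begin
    map wt (map (a ,_) (range1 (mult a α))) ≡⟨ map-∘ (range1 (mult a α)) ⟨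
    map (λ _ → a) (range1 (mult a α))       ≡⟨ map-const a (range1 (mult a α)) ⟩
    replicate (length (range1 (mult a α))) a
      ≡⟨ cong (λ n → replicate n a) (trans (length-map suc (upTo (mult a α))) (length-upTo (mult a α))) ⟩
    replicate (mult a α) a                  ≡⟨ replicate-mult a α ⟩
    filterᵇ (a ≡ᵇ_) α                       ∎

filterᵇ-∨-↭ : ∀ (p q : A → Bool) → (∀ x → p x ≡ true → q x ≡ false) → ∀ xs →
  filterᵇ p xs ++ filterᵇ q xs ↭ filterᵇ (λ x → p x ∨ q x) xs
filterᵇ-∨-↭ p q disjoint []       = Perm.refl
filterᵇ-∨-↭ p q disjoint (x ∷ xs) with p x in px | q x in qx
... | false | false = filterᵇ-∨-↭ p q disjoint xs
... | true  | false = Perm.prep x (filterᵇ-∨-↭ p q disjoint xs)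
... | false | true  = ↭-trans (shift x (filterᵇ p xs) (filterᵇ q xs)) (Perm.prep x (filterᵇ-∨-↭ p q disjoint xs))
... | true  | true  with () ← trans (sym qx) (disjoint x px)

-- A strictly increasing `ys` has no repetitions, so the filters are disjoint and collect no part
-- twice.
concatMap-filterᵇ-↭ : ∀ α {ys} → AllPairs _<_ ys →
  concatMap (λ a → filterᵇ (a ≡ᵇ_) α) ys ↭ filterᵇ (λ x → any (_≡ᵇ x) ys) α
concatMap-filterᵇ-↭ α {[]}     []             = ↭-reflexive (sym (filter-none _ (All.universal (λ _ ()) α)))
concatMap-filterᵇ-↭ α {a ∷ ys} (a<ys ∷ ys↗) =
  ↭-trans (++⁺ˡ (filterᵇ (a ≡ᵇ_) α) (concatMap-filterᵇ-↭ α ys↗)) (filterᵇ-∨-↭ _ _ disjoint α)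
  where
  absent : ∀ {a ys} → All (a <_) ys → any (_≡ᵇ a) ys ≡ false
  absent []           = refl
  absent (a<y ∷ a<ys) = cong₂ _∨_ (<⇒≡ᵇ≡false a<y) (absent a<ys)

  disjoint : ∀ x → (a ≡ᵇ x) ≡ true → any (_≡ᵇ x) ys ≡ false
  disjoint x a≡x with refl ← ≡ᵇ-sound a x a≡x = absent a<ys

any-map : ∀ (p : B → Bool) (h : A → B) xs → any p (map h xs) ≡ any (p ∘ h) xs
any-map p h xs = cong or (sym (map-∘ xs))

any-upTo : ∀ {i n} → i < n → any (_≡ᵇ i) (upTo n) ≡ true
any-upTo {zero}  {suc n} _           = refl
any-upTo {suc i} {suc n} (s≤s i<n) = begin
  any (_≡ᵇ suc i) (upTo (suc n))      ≡⟨ cong (any (_≡ᵇ suc i)) (upTo-suc n) ⟩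
  any (_≡ᵇ suc i) (map suc (upTo n))  ≡⟨ any-map (_≡ᵇ suc i) suc (upTo n) ⟩
  any (_≡ᵇ i) (upTo n)                ≡⟨ any-upTo i<n ⟩
  true                                ∎

any-range1 : ∀ {x n} → 0 < x → x ≤ n → any (_≡ᵇ x) (range1 n) ≡ true
any-range1 {suc x} {n} _ x<n = trans (any-map (_≡ᵇ suc x) suc (upTo n)) (any-upTo x<n)

All-≤-sum : ∀ α → All (_≤ sum α) α
All-≤-sum []      = []
All-≤-sum (x ∷ α) = m≤m+n x (sum α) ∷ All.map (λ y≤ → ≤-trans y≤ (m≤n+m (sum α) x)) (All-≤-sum α)

-- Every part lies between 1 and `sum α`, the range of the blocks of `elemsP`, so none is lost.
weights-elemsP-↭ : ∀ {α} → All (0 <_) α → map wt (elemsP α) ↭ α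
weights-elemsP-↭ {α} α>0 = subst₂ _↭_ (sym (weights-elemsP α))
  (filter-all _ (All.zipWith (λ (0<x , x≤) → Equivalence.from T-≡ (any-range1 0<x x≤)) (α>0 , All-≤-sum α)))
  (concatMap-filterᵇ-↭ α (range1-ascending (sum α)))

≥-decTotalOrder : DecTotalOrder _ _ _
≥-decTotalOrder = Flip.decTotalOrder ≤-decTotalOrder

private module ≥-Sort where
  open import Data.List.Sort.InsertionSort.Base ≥-decTotalOrder public
  open import Data.List.Sort.InsertionSort.Properties ≥-decTotalOrder public

sortDesc≡sort : ∀ xs → sortDesc xs ≡ ≥-Sort.sort xs
sortDesc≡sort []       = refl
sortDesc≡sort (x ∷ xs) = trans (cong (insertDesc x) (sortDesc≡sort xs)) (insertDesc≡insert (≥-Sort.sort xs))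
  where
  insertDesc≡insert : ∀ ys → insertDesc x ys ≡ ≥-Sort.insert x ys
  insertDesc≡insert []       = refl
  -- The decision made by the library sort has `y ≤ᵇ x` as its Boolean, so one case split reduces
  -- both sides.
  insertDesc≡insert (y ∷ ys) with y ≤ᵇ x
  ... | true  = refl
  ... | false = cong (y ∷_) (insertDesc≡insert ys)

sortDesc-↭ : ∀ xs → sortDesc xs ↭ xs
sortDesc-↭ xs = subst (_↭ xs) (sym (sortDesc≡sort xs)) (≥-Sort.sort-↭ xs)

-- Two weakly decreasing lists that are permutations of each other coincide. Thus column j of a
-- matrix belongs to the j-th element of P^α̃ in decreasing order.
weights-reverse-elemsP : ∀ {α} → All (0 <_) α → map wt (reverse (elemsP α)) ≡ sortDesc α
weights-reverse-elemsP {α} α>0 = trans (Pointwise-≡⇒≡ (↗↭↗⇒≋ O sorted (≥-Sort.sort-↗ α) (↭⇒↭ₛ perm))) (sym (sortDesc≡sort α))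
  where
  O = DecTotalOrder.totalOrder ≥-decTotalOrder
  sorted = AllPairs⇒Sorted O (AllPairs.map⁺ (AllPairs.map ⋗⇒≥ (AllPairs-reverse (elemsP-ascending α))))
  perm : map wt (reverse (elemsP α)) ↭ ≥-Sort.sort α
  perm = ↭-trans (Perm.map⁺ wt (↭-reverse (elemsP α)))
           (↭-trans (weights-elemsP-↭ α>0) (↭-sym (≥-Sort.sort-↭ α)))

-- The coefficients of 𝓅_α as matrix counts

-- Conditions (3) and (1) for the matrix with columns `z`. For chains, the same two factors say that
-- the weights read `α` and that f contributes x^e.
matches : List ℕ → List ℕ → List (ℕ × ℕ) → ℕ
matches α e z = ⟦ eqListᵇ (map proj₁ (sortRows z)) α ⟧ * ⟦ eqListᵇ (expVec (length e) (map term z)) e ⟧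

-- g lists, column by column, the row of the only nonzero entry.
assignments : List ℕ → List ℕ → ℕ
assignments α e = ∑[ g ∈ seqs (upTo (length e)) (length (sortDesc α)) ] matches α e (zip (sortDesc α) g)

zip-projections : ∀ (s : List NN) (f : List ℕ) → length f ≡ length s →
  map proj₁ (map (map₁ wt) (zip s f)) ≡ map wt s × map swap (map (map₁ wt) (zip s f)) ≡ zip f (map wt s)
zip-projections []      []      _  = refl , refl
zip-projections (x ∷ s) (v ∷ f) eq with zip-projections s f (suc-injective eq)
... | eq₁ , eq₂ = cong (wt x ∷_) eq₁ , cong ((v , wt x) ∷_) eq₂

coeffP-assignments : ∀ {α} → All (0 <_) α → ∀ e → coeffP α e ≡ assignments α e
coeffP-assignments {α} α>0 e = begin
  coeffP α e
    ≡⟨ ∑-filter _ (λ s → coeffK s e) (linearExtensions α) ⟩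
  (∑[ s ∈ linearExtensions α ] ⟦ eqListᵇ (αsw s) α ⟧ * coeffK s e)
    ≡⟨ ∑-cong (linearExtensions α) partitions ⟩
  (∑[ s ∈ perms (elemsP α) ] ∑[ f ∈ seqs R (length s) ] ⟦ isPartitionᵇ s f ⟧ * F (zip s f))
    ≡⟨ ∑-perms-↭ _ (↭-sym (↭-reverse (elemsP α))) ⟩
  (∑[ s ∈ perms E ] ∑[ f ∈ seqs R (length s) ] ⟦ isPartitionᵇ s f ⟧ * F (zip s f))
    ≡⟨ ∑-perms-sorted R F (AllPairs-reverse (elemsP-ascending α)) ⟩
  (∑[ g ∈ seqs R (length E) ] F (sortRows (zip E g)))
    -- Values of f start at 1, rows at 0.
    ≡⟨ ∑-seqs-map suc (upTo N) (length E) _ ⟩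
  (∑[ g ∈ seqs (upTo N) (length E) ] F (sortRows (zip E (map suc g))))
    ≡⟨ cong (λ k → ∑[ g ∈ seqs (upTo N) k ] F (sortRows (zip E (map suc g)))) (sym (length-map wt E)) ⟩
  (∑[ g ∈ seqs (upTo N) (length (map wt E)) ] F (sortRows (zip E (map suc g))))
    ≡⟨ ∑-cong (seqs (upTo N) (length (map wt E))) relabel ⟩
  (∑[ g ∈ seqs (upTo N) (length (map wt E)) ] matches α e (zip (map wt E) g))
    ≡⟨ cong (λ as → ∑[ g ∈ seqs (upTo N) (length as) ] matches α e (zip as g)) (weights-reverse-elemsP α>0) ⟩
  assignments α e ∎
  where
  N = length e
  R = range1 N
  E = reverse (elemsP α)

  H : List (ℕ × ℕ) → ℕ
  H z = ⟦ eqListᵇ (map proj₁ z) α ⟧ * ⟦ eqListᵇ (expVec N (map swap z)) e ⟧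

  -- Both conditions depend on the elements a_k through their weights alone, so k is discarded.
  F : List (NN × ℕ) → ℕ
  F z = H (map (map₁ wt) z)

  partitions : ∀ s → ⟦ eqListᵇ (αsw s) α ⟧ * coeffK s e ≡
                     (∑[ f ∈ seqs R (length s) ] ⟦ isPartitionᵇ s f ⟧ * F (zip s f))
  partitions s = begin
    ⟦ a ⟧ * coeffK s e
      ≡⟨ cong (⟦ a ⟧ *_) (countᵇ-∑ _ (seqs R (length s))) ⟩
    ⟦ a ⟧ * (∑[ f ∈ seqs R (length s) ] ⟦ isPartitionᵇ s f ∧ b f ⟧)
      ≡⟨ ∑-*ˡ ⟦ a ⟧ _ (seqs R (length s)) ⟨
    (∑[ f ∈ seqs R (length s) ] ⟦ a ⟧ * ⟦ isPartitionᵇ s f ∧ b f ⟧)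
      ≡⟨ ∑-cong (seqs R (length s)) (λ f → trans (cong (⟦ a ⟧ *_) (⟦∧⟧ (isPartitionᵇ s f) (b f)))
                              (*-swapˡ ⟦ a ⟧ ⟦ isPartitionᵇ s f ⟧ ⟦ b f ⟧)) ⟩
    (∑[ f ∈ seqs R (length s) ] ⟦ isPartitionᵇ s f ⟧ * (⟦ a ⟧ * ⟦ b f ⟧))
      ≡⟨ ∑-cong-local (All.map (λ {f} |f| → cong (⟦ isPartitionᵇ s f ⟧ *_) (sym (F-zip f |f|)))
           (seqs-length R (length s))) ⟩
    (∑[ f ∈ seqs R (length s) ] ⟦ isPartitionᵇ s f ⟧ * F (zip s f)) ∎
    where
    a = eqListᵇ (αsw s) α
    b : List ℕ → Bool
    b f = eqListᵇ (expVec N (zip f (map wt s))) e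

    F-zip : ∀ f → length f ≡ length s → F (zip s f) ≡ ⟦ a ⟧ * ⟦ b f ⟧
    F-zip f |f| = cong₂ (λ x y → ⟦ eqListᵇ x α ⟧ * ⟦ eqListᵇ (expVec N y) e ⟧)
                        (proj₁ (zip-projections s f |f|)) (proj₂ (zip-projections s f |f|))

  relabel : ∀ g → F (sortRows (zip E (map suc g))) ≡ matches α e (zip (map wt E) g)
  relabel g = begin
    H (map (map₁ wt) (sortRows (zip E (map suc g))))
      ≡⟨ cong H (sortRows-map (map₁ wt) (λ _ _ → refl) (zip E (map suc g))) ⟨
    H (sortRows (map (map₁ wt) (zip E (map suc g))))
      ≡⟨ cong (H ∘ sortRows) (trans (sym (zip-map wt id E (map suc g)))
           (trans (cong (zip (map wt E)) (map-id (map suc g)))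
             (trans (cong (λ as → zip as (map suc g)) (sym (map-id (map wt E))))
                    (zip-map id suc (map wt E) g)))) ⟩
    H (sortRows (map (map₂ suc) z))
      ≡⟨ cong H (sortRows-map (map₂ suc) (λ p q → ≤ᵇ-suc (proj₂ p) (proj₂ q)) z) ⟩
    H (map (map₂ suc) (sortRows z))
      ≡⟨ cong₂ (λ x y → ⟦ eqListᵇ x α ⟧ * ⟦ eqListᵇ (expVec N y) e ⟧)
           (sym (map-∘ (sortRows z))) (sym (map-∘ (sortRows z))) ⟩
    ⟦ eqListᵇ (map proj₁ (sortRows z)) α ⟧ * ⟦ eqListᵇ (expVec N (map term (sortRows z))) e ⟧
      -- Sorting only permutes the factors of the monomial, so the exponents can be read from the
      -- unsorted list.
      ≡⟨ cong (λ y → ⟦ eqListᵇ (map proj₁ (sortRows z)) α ⟧ * ⟦ eqListᵇ y e ⟧)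
           (expVec-↭ N (Perm.map⁺ term (sortRows-↭ z))) ⟩
    matches α e z ∎
    where z = zip (map wt E) g

seqs-All : ∀ {P : A → Set} {xs} → All P xs → ∀ k → All (All P) (seqs xs k)
seqs-All pxs zero    = [] ∷ []
seqs-All pxs (suc k) = All.concat⁺ (All.map⁺ (All.map (λ px → All.map⁺ (All.map (px ∷_) (seqs-All pxs k))) pxs))

Rαβ-assignments : ∀ {α} → All (0 <_) α → ∀ e → Rαβ α e ≡ assignments α e
Rαβ-assignments {α} α>0 e = begin
  Rαβ α e
    ≡⟨ countᵇ-∑ _ (seqs (seqs V (length α)) L) ⟩
  (∑[ m ∈ seqs (seqs V (length α)) L ] ⟦ matrixOKᵇ α e m ⟧)
    ≡⟨ ∑-cong (seqs (seqs V (length α)) L) split ⟩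
  (∑[ m ∈ seqs (seqs V (length α)) L ] ⟦ ok (length α) m ⟧ * G m)
    ≡⟨ cong (λ k → ∑[ m ∈ seqs (seqs V k) L ] ⟦ ok k m ⟧ * G m) (sym (Perm.↭-length (sortDesc-↭ α))) ⟩
  (∑[ m ∈ seqs (seqs V (length as)) L ] ⟦ ok (length as) m ⟧ * G m)
    ≡⟨ ∑-matrices G L (sum α) bounds ⟩
  (∑[ g ∈ seqs (upTo L) (length as) ] G (matrix L (zip as g)))
    ≡⟨ ∑-cong-local (All.map (λ {g} g<L → cong₂ (λ x y → ⟦ eqListᵇ x α ⟧ * ⟦ eqListᵇ y e ⟧)
         (reading-matrix L (zip-bounds (All.map proj₁ bounds) g<L)) (rowSums-matrix L (zip as g)))
         (seqs-All (All.all-upTo L) (length as))) ⟩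
  assignments α e ∎
  where
  L = length e
  V = range0 (sum α)
  as = sortDesc α

  ok : ℕ → List (List ℕ) → Bool
  ok k m = and (zipWith columnOKᵇ (columns k m) as)

  G : List (List ℕ) → ℕ
  G m = ⟦ eqListᵇ (nonzeros (concat m)) α ⟧ * ⟦ eqListᵇ (map sum m) e ⟧

  split : ∀ m → ⟦ matrixOKᵇ α e m ⟧ ≡ ⟦ ok (length α) m ⟧ * G m
  split m = begin
    ⟦ s ∧ c ∧ r ⟧            ≡⟨ ⟦∧⟧ s (c ∧ r) ⟩
    ⟦ s ⟧ * ⟦ c ∧ r ⟧        ≡⟨ cong (⟦ s ⟧ *_) (⟦∧⟧ c r) ⟩
    ⟦ s ⟧ * (⟦ c ⟧ * ⟦ r ⟧)  ≡⟨ *-comm ⟦ s ⟧ _ ⟩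
    ⟦ c ⟧ * ⟦ r ⟧ * ⟦ s ⟧    ≡⟨ *-assoc ⟦ c ⟧ ⟦ r ⟧ ⟦ s ⟧ ⟩
    ⟦ c ⟧ * (⟦ r ⟧ * ⟦ s ⟧)  ∎
    where
    s = eqListᵇ (map sum m) e
    c = ok (length α) m
    r = eqListᵇ (nonzeros (concat m)) α

  bounds : All (λ a → 0 < a × a ≤ sum α) as
  bounds = Perm.All-resp-↭ (↭-sym (sortDesc-↭ α)) (All.zip (α>0 , All-≤-sum α))

  zip-bounds : ∀ {as g} → All (0 <_) as → All (_< L) g → All (λ (a , i) → 0 < a × i < L) (zip as g)
  zip-bounds []           _            = []
  zip-bounds (_ ∷ _)      []           = []
  zip-bounds (a>0 ∷ as>0) (i<L ∷ g<L) = (a>0 , i<L) ∷ zip-bounds as>0 g<L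

-- Degrees and zero rows

eqListᵇ-sound : ∀ xs ys → eqListᵇ xs ys ≡ true → xs ≡ ys
eqListᵇ-sound []       []       _  = refl
eqListᵇ-sound (x ∷ xs) (y ∷ ys) eq =
  cong₂ _∷_ (≡ᵇ-sound x y (∧-trueˡ eq)) (eqListᵇ-sound xs ys (∧-trueʳ {x ≡ᵇ y} eq))

sum-nonzeros : ∀ xs → sum (nonzeros xs) ≡ sum xs
sum-nonzeros []           = refl
sum-nonzeros (zero ∷ xs)  = sum-nonzeros xs
sum-nonzeros (suc x ∷ xs) = cong (suc x +_) (sum-nonzeros xs)

sum-concat : ∀ m → sum (concat m) ≡ sum (map sum m)
sum-concat []      = refl
sum-concat (r ∷ m) = trans (sum-++ r (concat m)) (cong (sum r +_) (sum-concat m))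

-- Double counting: the entries of the matrix add up to `sum β` by rows and to `sum α` along the
-- reading word.
matrixOKᵇ-sum : ∀ α β m → matrixOKᵇ α β m ≡ true → sum β ≡ sum α
matrixOKᵇ-sum α β m ok = begin
  sum β                    ≡⟨ cong sum (eqListᵇ-sound (map sum m) β (∧-trueˡ ok)) ⟨
  sum (map sum m)          ≡⟨ sum-concat m ⟨
  sum (concat m)           ≡⟨ sum-nonzeros (concat m) ⟨
  sum (nonzeros (concat m))
    ≡⟨ cong sum (eqListᵇ-sound (nonzeros (concat m)) α
         (∧-trueʳ {and (zipWith columnOKᵇ (columns (length α) m) (sortDesc α))}
           (∧-trueʳ {eqListᵇ (map sum m) β} ok))) ⟩
  sum α                    ∎

Rαβ-sum : ∀ α β → Rαβ α β ≡ ⟦ sum β ≡ᵇ sum α ⟧ * Rαβ α β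
Rαβ-sum α β = begin
  Rαβ α β                                                ≡⟨ countᵇ-∑ _ ms ⟩
  (∑[ m ∈ ms ] ⟦ matrixOKᵇ α β m ⟧)                      ≡⟨ ∑-cong ms guarded ⟩
  (∑[ m ∈ ms ] ⟦ sum β ≡ᵇ sum α ⟧ * ⟦ matrixOKᵇ α β m ⟧) ≡⟨ ∑-*ˡ ⟦ sum β ≡ᵇ sum α ⟧ _ ms ⟩
  ⟦ sum β ≡ᵇ sum α ⟧ * (∑[ m ∈ ms ] ⟦ matrixOKᵇ α β m ⟧) ≡⟨ cong (⟦ sum β ≡ᵇ sum α ⟧ *_) (countᵇ-∑ _ ms) ⟨
  ⟦ sum β ≡ᵇ sum α ⟧ * Rαβ α β                           ∎
  where
  ms = seqs (seqs (range0 (sum α)) (length α)) (length β)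

  guarded : ∀ m → ⟦ matrixOKᵇ α β m ⟧ ≡ ⟦ sum β ≡ᵇ sum α ⟧ * ⟦ matrixOKᵇ α β m ⟧
  guarded m with matrixOKᵇ α β m in ok
  ... | false = sym (*-zeroʳ ⟦ sum β ≡ᵇ sum α ⟧)
  ... | true  rewrite matrixOKᵇ-sum α β m ok | ≡ᵇ-refl (sum α) = refl

-- The invariance of `H` is assumed behind an arbitrary prefix `p` so that it passes to `H ∘ (r ∷_)`
-- in the induction.
∑-delete-zero-rows : ∀ n k (H : List (List ℕ) → ℕ) →
  (∀ p m → H (p ++ replicate k 0 ∷ m) ≡ H (p ++ m)) → ∀ e →
  (∑[ m ∈ seqs (seqs (range0 n) k) (length e) ] ⟦ eqListᵇ (map sum m) e ⟧ * H m) ≡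
  (∑[ m ∈ seqs (seqs (range0 n) k) (length (nonzeros e)) ] ⟦ eqListᵇ (map sum m) (nonzeros e) ⟧ * H m)
∑-delete-zero-rows n k H inv []      = refl
∑-delete-zero-rows n k H inv (x ∷ e) = begin
  (∑[ m ∈ seqs Rows (suc (length e)) ] ⟦ eqListᵇ (map sum m) (x ∷ e) ⟧ * H m)
    ≡⟨ first-row x e ⟩
  (∑[ r ∈ Rows ] ⟦ sum r ≡ᵇ x ⟧ * (∑[ m ∈ seqs Rows (length e) ] ⟦ eqListᵇ (map sum m) e ⟧ * H (r ∷ m)))
    ≡⟨ ∑-cong Rows (λ r → cong (⟦ sum r ≡ᵇ x ⟧ *_)
         (∑-delete-zero-rows n k (H ∘ (r ∷_)) (λ p m → inv (r ∷ p) m) e)) ⟩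
  (∑[ r ∈ Rows ] ⟦ sum r ≡ᵇ x ⟧ * rest r)
    ≡⟨ by-cases x ⟩
  (∑[ m ∈ seqs Rows (length (nonzeros (x ∷ e))) ] ⟦ eqListᵇ (map sum m) (nonzeros (x ∷ e)) ⟧ * H m) ∎
  where
  Rows = seqs (range0 n) k

  rest : List ℕ → ℕ
  rest r = ∑[ m ∈ seqs Rows (length (nonzeros e)) ] ⟦ eqListᵇ (map sum m) (nonzeros e) ⟧ * H (r ∷ m)

  first-row : ∀ x e →
    (∑[ m ∈ seqs Rows (suc (length e)) ] ⟦ eqListᵇ (map sum m) (x ∷ e) ⟧ * H m) ≡
    (∑[ r ∈ Rows ] ⟦ sum r ≡ᵇ x ⟧ * (∑[ m ∈ seqs Rows (length e) ] ⟦ eqListᵇ (map sum m) e ⟧ * H (r ∷ m)))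
  first-row x e = trans (∑-seqs Rows (length e) _) (∑-cong Rows λ r →
    trans (∑-cong (seqs Rows (length e)) λ m →
             trans (cong (_* H (r ∷ m)) (⟦∧⟧ (sum r ≡ᵇ x) (eqListᵇ (map sum m) e)))
                   (*-assoc ⟦ sum r ≡ᵇ x ⟧ _ _))
          (∑-*ˡ ⟦ sum r ≡ᵇ x ⟧ _ (seqs Rows (length e))))

  by-cases : ∀ x → (∑[ r ∈ Rows ] ⟦ sum r ≡ᵇ x ⟧ * rest r) ≡
    (∑[ m ∈ seqs Rows (length (nonzeros (x ∷ e))) ] ⟦ eqListᵇ (map sum m) (nonzeros (x ∷ e)) ⟧ * H m)
  -- Only the zero row has sum zero, and `inv` deletes it.
  by-cases zero    = trans (∑-seqs-zero n k rest)
    (∑-cong (seqs Rows (length (nonzeros e))) λ m → cong (⟦ eqListᵇ (map sum m) (nonzeros e) ⟧ *_) (inv [] m))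
  by-cases (suc x) = sym (first-row (suc x) (nonzeros e))

zipWith-map-cong : ∀ {C D : Set} (f : B → C → D) {g h : A → B} → (∀ x c → f (g x) c ≡ f (h x) c) →
  ∀ xs cs → zipWith f (map g xs) cs ≡ zipWith f (map h xs) cs
zipWith-map-cong f eq []       cs       = refl
zipWith-map-cong f eq (x ∷ xs) []       = refl
zipWith-map-cong f eq (x ∷ xs) (c ∷ cs) = cong₂ _∷_ (eq x c) (zipWith-map-cong f eq xs cs)

nonzeros-replicate : ∀ k xs → nonzeros (replicate k 0 ++ xs) ≡ nonzeros xs
nonzeros-replicate zero    xs = refl
nonzeros-replicate (suc k) xs = nonzeros-replicate k xs

nth-replicate : ∀ k j → nth (replicate k 0) j ≡ 0
nth-replicate zero    j       = refl
nth-replicate (suc k) zero    = refl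
nth-replicate (suc k) (suc j) = nth-replicate k j

columnOKᵇ-zero : ∀ a xs ys → columnOKᵇ (xs ++ 0 ∷ ys) a ≡ columnOKᵇ (xs ++ ys) a
columnOKᵇ-zero a xs ys = cong₂ (λ n b → (n ≡ᵇ 1) ∧ b) (count xs) (entries xs)
  where
  count : ∀ xs → countᵇ nonzeroᵇ (xs ++ 0 ∷ ys) ≡ countᵇ nonzeroᵇ (xs ++ ys)
  count []           = refl
  count (zero ∷ xs)  = count xs
  count (suc x ∷ xs) = cong suc (count xs)

  entries : ∀ xs → all (λ x → (x ≡ᵇ 0) ∨ (x ≡ᵇ a)) (xs ++ 0 ∷ ys) ≡ all (λ x → (x ≡ᵇ 0) ∨ (x ≡ᵇ a)) (xs ++ ys)
  entries []       = refl
  entries (x ∷ xs) = cong (((x ≡ᵇ 0) ∨ (x ≡ᵇ a)) ∧_) (entries xs)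

Rαβ-nonzeros : ∀ α e → Rαβ α e ≡ Rαβ α (nonzeros e)
Rαβ-nonzeros α e = begin
  Rαβ α e
    ≡⟨ as-sum e ⟩
  (∑[ m ∈ seqs (seqs (range0 (sum α)) k) (length e) ] ⟦ eqListᵇ (map sum m) e ⟧ * H m)
    ≡⟨ ∑-delete-zero-rows (sum α) k H inv e ⟩
  (∑[ m ∈ seqs (seqs (range0 (sum α)) k) (length (nonzeros e)) ] ⟦ eqListᵇ (map sum m) (nonzeros e) ⟧ * H m)
    ≡⟨ as-sum (nonzeros e) ⟨
  Rαβ α (nonzeros e) ∎
  where
  k = length α

  H : List (List ℕ) → ℕ
  H m = ⟦ and (zipWith columnOKᵇ (columns k m) (sortDesc α)) ∧ eqListᵇ (nonzeros (concat m)) α ⟧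

  as-sum : ∀ e → Rαβ α e ≡
    (∑[ m ∈ seqs (seqs (range0 (sum α)) k) (length e) ] ⟦ eqListᵇ (map sum m) e ⟧ * H m)
  as-sum e = trans (countᵇ-∑ _ (seqs (seqs (range0 (sum α)) k) (length e)))
                   (∑-cong (seqs (seqs (range0 (sum α)) k) (length e)) λ m → ⟦∧⟧ (eqListᵇ (map sum m) e) _)

  -- A zero row adds one 0 to each column and a run of zeros to the concatenated entries; conditions
  -- (2) and (3) ignore both.
  inv : ∀ p m → H (p ++ replicate k 0 ∷ m) ≡ H (p ++ m)
  inv p m = cong₂ (λ cs xs → ⟦ and cs ∧ eqListᵇ xs α ⟧)
    (zipWith-map-cong columnOKᵇ column (upTo k) (sortDesc α)) reading
    where
    column : ∀ j a → columnOKᵇ (map (λ row → nth row j) (p ++ replicate k 0 ∷ m)) a ≡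
                     columnOKᵇ (map (λ row → nth row j) (p ++ m)) a
    column j a = begin
      columnOKᵇ (map nthⱼ (p ++ replicate k 0 ∷ m)) a
        ≡⟨ cong (λ c → columnOKᵇ c a) (map-++ nthⱼ p (replicate k 0 ∷ m)) ⟩
      columnOKᵇ (map nthⱼ p ++ nthⱼ (replicate k 0) ∷ map nthⱼ m) a
        ≡⟨ cong (λ x → columnOKᵇ (map nthⱼ p ++ x ∷ map nthⱼ m) a) (nth-replicate k j) ⟩
      columnOKᵇ (map nthⱼ p ++ 0 ∷ map nthⱼ m) a
        ≡⟨ columnOKᵇ-zero a (map nthⱼ p) (map nthⱼ m) ⟩
      columnOKᵇ (map nthⱼ p ++ map nthⱼ m) a
        ≡⟨ cong (λ c → columnOKᵇ c a) (map-++ nthⱼ p m) ⟨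
      columnOKᵇ (map nthⱼ (p ++ m)) a ∎
      where
      nthⱼ : List ℕ → ℕ
      nthⱼ row = nth row j

    reading : nonzeros (concat (p ++ replicate k 0 ∷ m)) ≡ nonzeros (concat (p ++ m))
    reading = begin
      nonzeros (concat (p ++ replicate k 0 ∷ m))
        ≡⟨ cong nonzeros (concat-++ p (replicate k 0 ∷ m)) ⟨
      nonzeros (concat p ++ (replicate k 0 ++ concat m))
        ≡⟨ filter-++ _ (concat p) _ ⟩
      nonzeros (concat p) ++ nonzeros (replicate k 0 ++ concat m)
        ≡⟨ cong (nonzeros (concat p) ++_) (nonzeros-replicate k (concat m)) ⟩
      nonzeros (concat p) ++ nonzeros (concat m)
        ≡⟨ filter-++ _ (concat p) _ ⟨
      nonzeros (concat p ++ concat m)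
        ≡⟨ cong nonzeros (concat-++ p m) ⟩
      nonzeros (concat (p ++ m)) ∎

-- Expansion in the monomial basis

pairwiseᵇ-map-suc : ∀ js → pairwiseᵇ _<ᵇ_ (map suc js) ≡ pairwiseᵇ _<ᵇ_ js
pairwiseᵇ-map-suc []       = refl
pairwiseᵇ-map-suc (j ∷ js) = cong₂ _∧_ (cong and (sym (map-∘ js))) (pairwiseᵇ-map-suc js)

all-positive-map-suc : ∀ js → all (0 <ᵇ_) (map suc js) ≡ true
all-positive-map-suc []       = refl
all-positive-map-suc (j ∷ js) = all-positive-map-suc js

all-positive-absorb : ∀ v js → all (v <ᵇ_) js ≡ all (0 <ᵇ_) js ∧ all (v <ᵇ_) js
all-positive-absorb v []           = refl
all-positive-absorb v (zero ∷ js)  = refl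
all-positive-absorb v (suc j ∷ js) with v <ᵇ suc j
... | true  = all-positive-absorb v js
... | false = sym (∧-zeroʳ (all (0 <ᵇ_) js))

∑-positive : ∀ N k (K : List ℕ → ℕ) →
  (∑[ js ∈ seqs (upTo (suc N)) k ] ⟦ all (0 <ᵇ_) js ⟧ * K js) ≡ (∑[ js ∈ seqs (upTo N) k ] K (map suc js))
∑-positive N zero    K = cong (_+ 0) (*-identityˡ (K []))
∑-positive N (suc k) K = begin
  (∑[ js ∈ seqs (upTo (suc N)) (suc k) ] ⟦ all (0 <ᵇ_) js ⟧ * K js)
    ≡⟨ ∑-seqs (upTo (suc N)) k _ ⟩
  (∑[ j ∈ upTo (suc N) ] ∑[ js ∈ seqs (upTo (suc N)) k ] ⟦ (0 <ᵇ j) ∧ all (0 <ᵇ_) js ⟧ * K (j ∷ js))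
    ≡⟨ ∑-upTo-suc _ N ⟩
  (∑[ js ∈ seqs (upTo (suc N)) k ] 0) +
  (∑[ j ∈ upTo N ] ∑[ js ∈ seqs (upTo (suc N)) k ] ⟦ all (0 <ᵇ_) js ⟧ * K (suc j ∷ js))
    ≡⟨ cong₂ _+_ (∑-zero (seqs (upTo (suc N)) k)) (∑-cong (upTo N) λ j → ∑-positive N k _) ⟩
  (∑[ j ∈ upTo N ] ∑[ js ∈ seqs (upTo N) k ] K (map suc (j ∷ js)))
    ≡⟨ ∑-seqs (upTo N) k _ ⟨
  (∑[ js ∈ seqs (upTo N) (suc k) ] K (map suc js)) ∎

-- An increasing index sequence either begins with the first variable or avoids it. In both cases
-- all later indices are positive and can be shifted down.
∑-increasing : ∀ N k (G : List ℕ → ℕ) →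
  (∑[ js ∈ seqs (upTo (suc N)) (suc k) ] ⟦ pairwiseᵇ _<ᵇ_ js ⟧ * G js) ≡
  (∑[ js ∈ seqs (upTo N) k ] ⟦ pairwiseᵇ _<ᵇ_ js ⟧ * G (0 ∷ map suc js)) +
  (∑[ js ∈ seqs (upTo N) (suc k) ] ⟦ pairwiseᵇ _<ᵇ_ js ⟧ * G (map suc js))
∑-increasing N k G = begin
  (∑[ js ∈ seqs (upTo (suc N)) (suc k) ] ⟦ S js ⟧ * G js)
    ≡⟨ ∑-seqs (upTo (suc N)) k _ ⟩
  (∑[ v ∈ upTo (suc N) ] ∑[ js ∈ seqs (upTo (suc N)) k ] ⟦ S (v ∷ js) ⟧ * G (v ∷ js))
    ≡⟨ ∑-cong (upTo (suc N)) tail-positive ⟩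
  (∑[ v ∈ upTo (suc N) ] ∑[ js ∈ seqs (upTo N) k ] ⟦ S (v ∷ map suc js) ⟧ * G (v ∷ map suc js))
    ≡⟨ ∑-upTo-suc _ N ⟩
  (∑[ js ∈ seqs (upTo N) k ] ⟦ S (0 ∷ map suc js) ⟧ * G (0 ∷ map suc js)) +
  (∑[ v ∈ upTo N ] ∑[ js ∈ seqs (upTo N) k ] ⟦ S (map suc (v ∷ js)) ⟧ * G (map suc (v ∷ js)))
    ≡⟨ cong₂ _+_
         (∑-cong (seqs (upTo N) k) λ js → cong (λ b → ⟦ b ⟧ * G (0 ∷ map suc js))
            (cong₂ _∧_ (all-positive-map-suc js) (pairwiseᵇ-map-suc js)))
         (trans (sym (∑-seqs (upTo N) k _))
                (∑-cong (seqs (upTo N) (suc k)) λ js →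
                   cong (λ b → ⟦ b ⟧ * G (map suc js)) (pairwiseᵇ-map-suc js))) ⟩
  (∑[ js ∈ seqs (upTo N) k ] ⟦ S js ⟧ * G (0 ∷ map suc js)) +
  (∑[ js ∈ seqs (upTo N) (suc k) ] ⟦ S js ⟧ * G (map suc js)) ∎
  where
  S = pairwiseᵇ _<ᵇ_

  tail-positive : ∀ v → (∑[ js ∈ seqs (upTo (suc N)) k ] ⟦ S (v ∷ js) ⟧ * G (v ∷ js)) ≡
                        (∑[ js ∈ seqs (upTo N) k ] ⟦ S (v ∷ map suc js) ⟧ * G (v ∷ map suc js))
  tail-positive v = trans (∑-cong (seqs (upTo (suc N)) k) guarded) (∑-positive N k _)
    where
    guarded : ∀ js → ⟦ S (v ∷ js) ⟧ * G (v ∷ js) ≡ ⟦ all (0 <ᵇ_) js ⟧ * (⟦ S (v ∷ js) ⟧ * G (v ∷ js))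
    guarded js = begin
      ⟦ all (v <ᵇ_) js ∧ S js ⟧ * G (v ∷ js)
        ≡⟨ cong (λ b → ⟦ b ∧ S js ⟧ * G (v ∷ js)) (all-positive-absorb v js) ⟩
      ⟦ (pos ∧ all (v <ᵇ_) js) ∧ S js ⟧ * G (v ∷ js)
        ≡⟨ cong (λ b → ⟦ b ⟧ * G (v ∷ js)) (∧-assoc pos _ _) ⟩
      ⟦ pos ∧ S (v ∷ js) ⟧ * G (v ∷ js)
        ≡⟨ cong (_* G (v ∷ js)) (⟦∧⟧ pos (S (v ∷ js))) ⟩
      ⟦ pos ⟧ * ⟦ S (v ∷ js) ⟧ * G (v ∷ js)
        ≡⟨ *-assoc ⟦ pos ⟧ _ _ ⟩
      ⟦ pos ⟧ * (⟦ S (v ∷ js) ⟧ * G (v ∷ js)) ∎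
      where pos = all (0 <ᵇ_) js

expVec-shift : ∀ N z → expVec (suc N) (map term (map (map₂ suc) z)) ≡ 0 ∷ expVec N (map term z)
expVec-shift N []            = trans (expVec-[] (suc N)) (cong (0 ∷_) (sym (expVec-[] N)))
expVec-shift N ((a , i) ∷ z) = begin
  expVec (suc N) (map term (map (map₂ suc) ((a , i) ∷ z)))
    ≡⟨ expVec-∷ (suc N) (suc i) a _ ⟩
  zipWith _+_ (0 ∷ unit N i a) (expVec (suc N) (map term (map (map₂ suc) z)))
    ≡⟨ cong (zipWith _+_ (0 ∷ unit N i a)) (expVec-shift N z) ⟩
  0 ∷ zipWith _+_ (unit N i a) (expVec N (map term z))
    ≡⟨ cong (0 ∷_) (expVec-∷ N i a (map term z)) ⟨
  0 ∷ expVec N (map term ((a , i) ∷ z)) ∎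

length-expVec : ∀ N vw → length (expVec N vw) ≡ N
length-expVec N vw = trans (length-map _ (range1 N)) (trans (length-map suc (upTo N)) (length-upTo N))

expVec-first : ∀ N b z → expVec (suc N) (map term ((b , 0) ∷ map (map₂ suc) z)) ≡ b ∷ expVec N (map term z)
expVec-first N b z = begin
  expVec (suc N) (map term ((b , 0) ∷ map (map₂ suc) z))
    ≡⟨ expVec-∷ (suc N) 0 b _ ⟩
  zipWith _+_ (b ∷ replicate N 0) (expVec (suc N) (map term (map (map₂ suc) z)))
    ≡⟨ cong (zipWith _+_ (b ∷ replicate N 0)) (expVec-shift N z) ⟩
  b + 0 ∷ zipWith _+_ (replicate N 0) X
    ≡⟨ cong₂ _∷_ (+-identityʳ b)
         (trans (cong (λ n → zipWith _+_ (replicate n 0) X) (sym (length-expVec N (map term z))))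
                (zipWith-+-zeros X)) ⟩
  b ∷ X ∎
  where X = expVec N (map term z)

zip-mapʳ : ∀ {C : Set} (h : B → C) (xs : List A) ys → zip xs (map h ys) ≡ map (map₂ h) (zip xs ys)
zip-mapʳ h xs ys = trans (cong (λ as → zip as (map h ys)) (sym (map-id xs))) (zip-map id h xs ys)

zip-term : ∀ js β → zip (map suc js) β ≡ map term (zip β js)
zip-term []       []      = refl
zip-term []       (_ ∷ _) = refl
zip-term (_ ∷ _)  []      = refl
zip-term (j ∷ js) (b ∷ β) = cong ((suc j , b) ∷_) (zip-term js β)

-- The count of `coeffM` with variables numbered from 0, prepared for recursion on `e`.
embeddings : List ℕ → List ℕ → ℕ
embeddings β e = ∑[ js ∈ seqs (upTo (length e)) (length β) ]
  ⟦ pairwiseᵇ _<ᵇ_ js ⟧ * ⟦ eqListᵇ (expVec (length e) (map term (zip β js))) e ⟧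

coeffM-embeddings : ∀ β e → coeffM β e ≡ embeddings β e
coeffM-embeddings β e = begin
  coeffM β e
    ≡⟨ countᵇ-∑ _ (seqs (range1 N) (length β)) ⟩
  (∑[ js ∈ seqs (range1 N) (length β) ] ⟦ pairwiseᵇ _<ᵇ_ js ∧ eqListᵇ (expVec N (zip js β)) e ⟧)
    ≡⟨ ∑-seqs-map suc (upTo N) (length β) _ ⟩
  (∑[ js ∈ seqs (upTo N) (length β) ]
     ⟦ pairwiseᵇ _<ᵇ_ (map suc js) ∧ eqListᵇ (expVec N (zip (map suc js) β)) e ⟧)
    ≡⟨ ∑-cong (seqs (upTo N) (length β)) (λ js → trans
         (cong₂ (λ b vw → ⟦ b ∧ eqListᵇ (expVec N vw) e ⟧) (pairwiseᵇ-map-suc js) (zip-term js β))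
         (⟦∧⟧ (pairwiseᵇ _<ᵇ_ js) _)) ⟩
  embeddings β e ∎
  where N = length e

embeddings-[]-∷ : ∀ x e → embeddings [] (x ∷ e) ≡ ⟦ 0 ≡ᵇ x ⟧ * embeddings [] e
embeddings-[]-∷ x e = begin
  1 * ⟦ eqListᵇ (expVec (suc N) []) (x ∷ e) ⟧ + 0
    ≡⟨ cong (λ xs → 1 * ⟦ eqListᵇ xs (x ∷ e) ⟧ + 0) (expVec-shift N []) ⟩
  1 * ⟦ (0 ≡ᵇ x) ∧ eqListᵇ (expVec N []) e ⟧ + 0
    ≡⟨ trans (+-identityʳ _) (*-identityˡ _) ⟩
  ⟦ (0 ≡ᵇ x) ∧ eqListᵇ (expVec N []) e ⟧
    ≡⟨ ⟦∧⟧ (0 ≡ᵇ x) _ ⟩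
  ⟦ 0 ≡ᵇ x ⟧ * ⟦ eqListᵇ (expVec N []) e ⟧
    ≡⟨ cong (⟦ 0 ≡ᵇ x ⟧ *_) (trans (+-identityʳ _) (*-identityˡ _)) ⟨
  ⟦ 0 ≡ᵇ x ⟧ * embeddings [] e ∎
  where N = length e

-- The first variable either carries the part `b`, which forces the exponent `x` to be `b`, or does
-- not occur, which forces `x` to be 0.
embeddings-∷-∷ : ∀ b β x e →
  embeddings (b ∷ β) (x ∷ e) ≡ ⟦ b ≡ᵇ x ⟧ * embeddings β e + ⟦ 0 ≡ᵇ x ⟧ * embeddings (b ∷ β) e
embeddings-∷-∷ b β x e = begin
  embeddings (b ∷ β) (x ∷ e)
    ≡⟨ ∑-increasing N (length β) G ⟩
  (∑[ js ∈ seqs (upTo N) (length β) ] ⟦ pairwiseᵇ _<ᵇ_ js ⟧ * G (0 ∷ map suc js)) +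
  (∑[ js ∈ seqs (upTo N) (suc (length β)) ] ⟦ pairwiseᵇ _<ᵇ_ js ⟧ * G (map suc js))
    ≡⟨ cong₂ _+_
         (factor (b ≡ᵇ x) (seqs (upTo N) (length β)) (λ js → 0 ∷ map suc js) λ js → cong (λ xs → ⟦ eqListᵇ xs (x ∷ e) ⟧)
           (trans (cong (λ z → expVec (suc N) (map term ((b , 0) ∷ z))) (zip-mapʳ suc β js))
                  (expVec-first N b (zip β js))))
         (factor (0 ≡ᵇ x) (seqs (upTo N) (suc (length β))) (map suc) λ js → cong (λ xs → ⟦ eqListᵇ xs (x ∷ e) ⟧)
           (trans (cong (λ z → expVec (suc N) (map term z)) (zip-mapʳ suc (b ∷ β) js))
                  (expVec-shift N (zip (b ∷ β) js)))) ⟩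
  ⟦ b ≡ᵇ x ⟧ * embeddings β e + ⟦ 0 ≡ᵇ x ⟧ * embeddings (b ∷ β) e ∎
  where
  N = length e

  G : List ℕ → ℕ
  G js = ⟦ eqListᵇ (expVec (suc N) (map term (zip (b ∷ β) js))) (x ∷ e) ⟧

  factor : ∀ c jss (h : List ℕ → List ℕ) {k : List ℕ → Bool} → (∀ js → G (h js) ≡ ⟦ c ∧ k js ⟧) →
    (∑[ js ∈ jss ] ⟦ pairwiseᵇ _<ᵇ_ js ⟧ * G (h js)) ≡ ⟦ c ⟧ * (∑[ js ∈ jss ] ⟦ pairwiseᵇ _<ᵇ_ js ⟧ * ⟦ k js ⟧)
  factor c jss h {k} eq = trans
    (∑-cong jss λ js → trans (cong (⟦ pairwiseᵇ _<ᵇ_ js ⟧ *_) (trans (eq js) (⟦∧⟧ c (k js))))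
                             (*-swapˡ ⟦ pairwiseᵇ _<ᵇ_ js ⟧ ⟦ c ⟧ ⟦ k js ⟧))
    (∑-*ˡ ⟦ c ⟧ _ jss)

-- As parts are positive, a zero exponent must be skipped and a positive one must equal the next
-- part, so the recursion never branches.
embeddings-indicator : ∀ {β} → All (0 <_) β → ∀ e → embeddings β e ≡ ⟦ eqListᵇ β (nonzeros e) ⟧
embeddings-indicator []      []        = refl
embeddings-indicator (_ ∷ _) []        = refl
embeddings-indicator []      (zero ∷ e) =
  trans (embeddings-[]-∷ 0 e) (trans (*-identityˡ _) (embeddings-indicator [] e))
embeddings-indicator []      (suc x ∷ e) = embeddings-[]-∷ (suc x) e
embeddings-indicator {suc b ∷ β} (b>0 ∷ β>0) (zero ∷ e) =
  trans (embeddings-∷-∷ (suc b) β 0 e) (trans (*-identityˡ _) (embeddings-indicator (b>0 ∷ β>0) e))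
embeddings-indicator {b ∷ β} (b>0 ∷ β>0) (suc x ∷ e) = begin
  embeddings (b ∷ β) (suc x ∷ e)
    ≡⟨ embeddings-∷-∷ b β (suc x) e ⟩
  ⟦ b ≡ᵇ suc x ⟧ * embeddings β e + 0
    ≡⟨ +-identityʳ _ ⟩
  ⟦ b ≡ᵇ suc x ⟧ * embeddings β e
    ≡⟨ cong (⟦ b ≡ᵇ suc x ⟧ *_) (embeddings-indicator β>0 e) ⟩
  ⟦ b ≡ᵇ suc x ⟧ * ⟦ eqListᵇ β (nonzeros e) ⟧
    ≡⟨ ⟦∧⟧ (b ≡ᵇ suc x) _ ⟨
  ⟦ eqListᵇ (b ∷ β) (nonzeros (suc x ∷ e)) ⟧ ∎

coeffM-indicator : ∀ {β} → All (0 <_) β → ∀ e → coeffM β e ≡ ⟦ eqListᵇ β (nonzeros e) ⟧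
coeffM-indicator {β} β>0 e = trans (coeffM-embeddings β e) (embeddings-indicator β>0 e)

-- Summation over compositions

∑-eqListᵇ : ∀ n l {γ} → All (λ x → 0 < x × x ≤ n) γ →
  (∑[ β ∈ seqs (range1 n) l ] ⟦ eqListᵇ β γ ⟧) ≡ ⟦ l ≡ᵇ length γ ⟧
∑-eqListᵇ n zero    []      = refl
∑-eqListᵇ n zero    (_ ∷ _) = refl
∑-eqListᵇ n (suc l) []      = begin
  (∑[ β ∈ seqs (range1 n) (suc l) ] ⟦ eqListᵇ β [] ⟧)
    ≡⟨ ∑-seqs (range1 n) l _ ⟩
  (∑[ x ∈ range1 n ] ∑[ β ∈ seqs (range1 n) l ] 0)
    ≡⟨ ∑-cong (range1 n) (λ _ → ∑-zero (seqs (range1 n) l)) ⟩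
  (∑[ x ∈ range1 n ] 0)
    ≡⟨ ∑-zero (range1 n) ⟩
  0 ∎
∑-eqListᵇ n (suc l) {suc y ∷ γ} ((_ , y<n) ∷ bounds) = begin
  (∑[ β ∈ seqs (range1 n) (suc l) ] ⟦ eqListᵇ β (suc y ∷ γ) ⟧)
    ≡⟨ ∑-seqs (range1 n) l _ ⟩
  (∑[ x ∈ range1 n ] ∑[ β ∈ seqs (range1 n) l ] ⟦ (x ≡ᵇ suc y) ∧ eqListᵇ β γ ⟧)
    ≡⟨ ∑-cong (range1 n) (λ x → trans (∑-cong (seqs (range1 n) l) λ β → ⟦∧⟧ (x ≡ᵇ suc y) (eqListᵇ β γ))
                                      (∑-*ˡ ⟦ x ≡ᵇ suc y ⟧ _ (seqs (range1 n) l))) ⟩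
  (∑[ x ∈ range1 n ] ⟦ x ≡ᵇ suc y ⟧ * (∑[ β ∈ seqs (range1 n) l ] ⟦ eqListᵇ β γ ⟧))
    ≡⟨ ∑-cong (range1 n) (λ x → cong (⟦ x ≡ᵇ suc y ⟧ *_) (∑-eqListᵇ n l bounds)) ⟩
  (∑[ x ∈ range1 n ] ⟦ x ≡ᵇ suc y ⟧ * ⟦ l ≡ᵇ length γ ⟧)
    ≡⟨ ∑-map _ suc (upTo n) ⟩
  (∑[ x ∈ upTo n ] ⟦ x ≡ᵇ y ⟧ * ⟦ l ≡ᵇ length γ ⟧)
    ≡⟨ ∑-δ (λ _ → ⟦ l ≡ᵇ length γ ⟧) y<n ⟩
  ⟦ l ≡ᵇ length γ ⟧ ∎

length≤sum : ∀ {γ} → All (0 <_) γ → length γ ≤ sum γ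
length≤sum []          = z≤n
length≤sum (x>0 ∷ γ>0) = +-mono-≤ x>0 (length≤sum γ>0)

all-positive⇒All : ∀ β → all (λ a → 0 <ᵇ a) β ≡ true → All (0 <_) β
all-positive⇒All []          _  = []
all-positive⇒All (suc b ∷ β) eq = s≤s z≤n ∷ all-positive⇒All β eq

All⇒all-positive : ∀ {β} → All (0 <_) β → all (λ a → 0 <ᵇ a) β ≡ true
All⇒all-positive []                    = refl
All⇒all-positive {suc b ∷ β} (_ ∷ β>0) = All⇒all-positive β>0

nonzeros-positive : ∀ e → All (0 <_) (nonzeros e)
nonzeros-positive []          = []
nonzeros-positive (zero ∷ e)  = nonzeros-positive e
nonzeros-positive (suc x ∷ e) = s≤s z≤n ∷ nonzeros-positive e

∑-compositions : ∀ n (K : List ℕ → ℕ) → ∑ (compositions n) K ≡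
  (∑[ l ∈ range0 n ] ∑[ β ∈ seqs (range1 n) l ] ⟦ isCompositionᵇ n β ⟧ * K β)
∑-compositions n K = trans (∑-concatMap K (λ l → filterᵇ (isCompositionᵇ n) (seqs (range1 n) l)) (range0 n))
  (∑-cong (range0 n) λ l → ∑-filter (isCompositionᵇ n) K (seqs (range1 n) l))

-- Neither the length of `γ` nor any of its parts exceeds `sum γ`, so `γ` lies within the enumerated
-- range and is met exactly once.
∑-compositions-δ : ∀ {γ} → All (0 <_) γ → ∀ r →
  (∑[ l ∈ range0 (sum γ) ] ∑[ β ∈ seqs (range1 (sum γ)) l ] ⟦ eqListᵇ β γ ⟧ * r) ≡ r
∑-compositions-δ {γ} γ>0 r = begin
  (∑[ l ∈ range0 n ] ∑[ β ∈ seqs (range1 n) l ] ⟦ eqListᵇ β γ ⟧ * r)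
    ≡⟨ ∑-cong (range0 n) constant ⟩
  (∑[ l ∈ range0 n ] ⟦ l ≡ᵇ length γ ⟧ * r)
    ≡⟨ ∑-δ (λ _ → r) (s≤s (length≤sum γ>0)) ⟩
  r ∎
  where
  n = sum γ

  constant : ∀ l → (∑[ β ∈ seqs (range1 n) l ] ⟦ eqListᵇ β γ ⟧ * r) ≡ ⟦ l ≡ᵇ length γ ⟧ * r
  constant l = begin
    (∑[ β ∈ seqs (range1 n) l ] ⟦ eqListᵇ β γ ⟧ * r)  ≡⟨ ∑-cong (seqs (range1 n) l) (λ β → *-comm ⟦ eqListᵇ β γ ⟧ r) ⟩
    (∑[ β ∈ seqs (range1 n) l ] r * ⟦ eqListᵇ β γ ⟧)  ≡⟨ ∑-*ˡ r _ (seqs (range1 n) l) ⟩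
    r * (∑[ β ∈ seqs (range1 n) l ] ⟦ eqListᵇ β γ ⟧)
      ≡⟨ cong (r *_) (∑-eqListᵇ n l (All.zip (γ>0 , All-≤-sum γ))) ⟩
    r * ⟦ l ≡ᵇ length γ ⟧                             ≡⟨ *-comm r _ ⟩
    ⟦ l ≡ᵇ length γ ⟧ * r                             ∎

-- Extracts the coefficient of x^e from an arbitrary combination of the M_β of degree `n`; only the
-- degree of x^e can make it vanish irrespective of `R`.
∑-coeffM : ∀ n (R : List ℕ → ℕ) e →
  (∑[ β ∈ compositions n ] R β * coeffM β e) ≡ ⟦ sum (nonzeros e) ≡ᵇ n ⟧ * R (nonzeros e)
∑-coeffM n R e = begin
  (∑[ β ∈ compositions n ] R β * coeffM β e)
    ≡⟨ ∑-compositions n _ ⟩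
  (∑[ l ∈ range0 n ] ∑[ β ∈ seqs (range1 n) l ] ⟦ isCompositionᵇ n β ⟧ * (R β * coeffM β e))
    ≡⟨ ∑-cong (range0 n) (λ l → ∑-cong (seqs (range1 n) l) localize) ⟩
  (∑[ l ∈ range0 n ] ∑[ β ∈ seqs (range1 n) l ] ⟦ eqListᵇ β γ ⟧ * (⟦ sum γ ≡ᵇ n ⟧ * R γ))
    ≡⟨ evaluate ⟩
  ⟦ sum γ ≡ᵇ n ⟧ * R γ ∎
  where
  γ = nonzeros e

  localize : ∀ β → ⟦ isCompositionᵇ n β ⟧ * (R β * coeffM β e) ≡ ⟦ eqListᵇ β γ ⟧ * (⟦ sum γ ≡ᵇ n ⟧ * R γ)
  localize β = begin
    ⟦ isCompositionᵇ n β ⟧ * (R β * coeffM β e)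
      -- Positivity of the parts of `β`, required by `coeffM-indicator`, is available only under the
      -- composition indicator.
      ≡⟨ guard-cong (isCompositionᵇ n β) (λ comp →
           cong (R β *_) (coeffM-indicator (all-positive⇒All β (∧-trueˡ comp)) e)) ⟩
    ⟦ isCompositionᵇ n β ⟧ * (R β * ⟦ eqListᵇ β γ ⟧)
      ≡⟨ *-assoc ⟦ isCompositionᵇ n β ⟧ (R β) _ ⟨
    ⟦ isCompositionᵇ n β ⟧ * R β * ⟦ eqListᵇ β γ ⟧
      ≡⟨ *-comm _ ⟦ eqListᵇ β γ ⟧ ⟩
    ⟦ eqListᵇ β γ ⟧ * (⟦ isCompositionᵇ n β ⟧ * R β)
      ≡⟨ guard-cong (eqListᵇ β γ) (λ β≡γ →
           cong (λ δ → ⟦ isCompositionᵇ n δ ⟧ * R δ) (eqListᵇ-sound β γ β≡γ)) ⟩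
    ⟦ eqListᵇ β γ ⟧ * (⟦ isCompositionᵇ n γ ⟧ * R γ)
      ≡⟨ cong (λ b → ⟦ eqListᵇ β γ ⟧ * (⟦ b ∧ (sum γ ≡ᵇ n) ⟧ * R γ)) (All⇒all-positive (nonzeros-positive e)) ⟩
    ⟦ eqListᵇ β γ ⟧ * (⟦ sum γ ≡ᵇ n ⟧ * R γ) ∎

  evaluate : (∑[ l ∈ range0 n ] ∑[ β ∈ seqs (range1 n) l ] ⟦ eqListᵇ β γ ⟧ * (⟦ sum γ ≡ᵇ n ⟧ * R γ)) ≡
             ⟦ sum γ ≡ᵇ n ⟧ * R γ
  evaluate with sum γ ≡ᵇ n in eq
  -- In equal degree `n` is identified with `sum γ`, the bound of the enumeration; in different
  -- degree every term is zero.
  ... | true  with refl ← ≡ᵇ-sound (sum γ) n eq = ∑-compositions-δ (nonzeros-positive e) _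
  ... | false = trans
    (∑-cong (range0 n) λ l → trans (∑-cong (seqs (range1 n) l) λ β → *-zeroʳ ⟦ eqListᵇ β γ ⟧)
                                   (∑-zero (seqs (range1 n) l)))
    (∑-zero (range0 n))

theorem5p8 : (n : ℕ) (α : List ℕ) → IsComposition n α →
    (e : List ℕ) →
    coeffP α e ≡ sum (map (λ β → Rαβ α β * coeffM β e) (compositions n))
theorem5p8 n α (α>0 , refl) e = begin
  coeffP α e                                                ≡⟨ coeffP-assignments α>0 e ⟩
  assignments α e                                           ≡⟨ Rαβ-assignments α>0 e ⟨
  Rαβ α e                                                   ≡⟨ Rαβ-nonzeros α e ⟩
  -- The sum over compositions of fixed size carries a degree indicator, which the matrix count can
  -- absorb because it vanishes in other degrees.
  Rαβ α (nonzeros e)                                        ≡⟨ Rαβ-sum α (nonzeros e) ⟩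
  ⟦ sum (nonzeros e) ≡ᵇ sum α ⟧ * Rαβ α (nonzeros e)        ≡⟨ ∑-coeffM (sum α) (Rαβ α) e ⟨
  (∑[ β ∈ compositions (sum α) ] Rαβ α β * coeffM β e)      ∎
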